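{- Let $p$ be a prime and let $\alpha$ be a multiplicative arithmetic function, considered locally at $p$. (1) $\alpha$ is of type 1, i.e. $(\mathrm{fin},\mathrm{fin})$, at $p$ if and only if $\alpha$ is the convolution identity at $p$ (that is, $\alpha(p^n)=0$ for all $n\ge1$). (2) If $\alpha$ is positive at $p$, then it is of type 2, i.e. $(\infty,\mathrm{fin})$; if $\alpha$ is negative at $p$, then it is of type 3, i.e. $(\mathrm{fin},\infty)$.
   Context: A multiplicative arithmetic function is a function $\alpha:\mathbb{N}_{\ge1}\to\mathbb{C}$, not identically zero, with $\alpha(mn)=\alpha(m)\alpha(n)$ whenever $\gcd(m,n)=1$; it is completely multiplicative if this holds for all $m,n$. Dirichlet convolution is $(\alpha*\beta)(n)=\sum_{d\mid n}\alpha(d)\beta(n/d)$. Generalized Fibonacci polynomials: $F_0=1$ and, for $n\ge1$, $F_n(t_1,\dots,t_n)=\sum\binom{a_1+\dots+a_n}{a_1,\dots,a_n}t_1^{a_1}\cdots t_n^{a_n}$, the sum being over tuples of non-negative integers with $\sum_j ja_j=n$. The parameters of $\alpha$ at $p$ are the unique complex numbers $t_1,t_2,\dots$ such that $F_n(t_1,\dots,t_n)=\alpha(p^n)$ for all $n\ge0$. Type of $\alpha$ at $p$: the pair (range, domain), where the range is "fin" if $\alpha(p^n)=0$ for all sufficiently large $n$ and "$\infty$" otherwise, and the domain is "fin" if $t_j=0$ for all sufficiently large $j$ and "$\infty$" otherwise. Type 1 is $(\mathrm{fin},\mathrm{fin})$, type 2 is $(\infty,\mathrm{fin})$, type 3 is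 $(\mathrm{fin},\infty)$, type 4 is $(\infty,\infty)$. $\alpha$ is positive at $p$ if, on powers of $p$, it is a convolution product of $r\ge1$ completely multiplicative functions of degree 1 at $p$, i.e. completely multiplicative functions $\beta$ with $\beta(p)\ne0$. It is negative at $p$ if it is the convolution inverse of such a product. -}

module Defs where

open import Algebra.Bundles using (CommutativeRing; Semiring)
open import Algebra.Structures using (IsCommutativeRing)
open import Data.Fin.Base using (Fin; toℕ)
open import Data.List.Base as List
  using (List; []; _∷_; cartesianProductWith; filter; upTo)
open import Data.Nat.Base as ℕ using (ℕ; zero; suc; _!; _⊔_)
import Data.Nat.Properties as ℕₚ
open import Data.Nat.Divisibility using (_∣_; _∣?_; quotient; quotient≢0)
open import Data.Nat.GCD using (gcd)
open import Data.Nat.Primality using (Prime; prime⇒nonZero)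
open import Data.Product.Base using (∃; _×_; _,_)
import Data.Rational.Base
open import Data.Rational.Base as ℚ
  using (ℚ; 0ℚ; 1ℚ; ½; ∣_∣; _<_; _≤_; 1/_; Positive; positive; nonNegative)
import Data.Rational.Properties as ℚₚ
open import Data.Rational.Solver using (module +-*-Solver)
open import Data.Vec.Base as Vec using (Vec; []; _∷_; lookup)
open import Data.Vec.Functional as Vector using (Vector)
open import Function.Base using (_∘_)
open import Level using (0ℓ)
open import Relation.Binary.PropositionalEquality
  using (_≡_; refl; sym; trans; cong; subst)
open import Relation.Binary.Bundles using (Setoid)
open import Relation.Binary.Structures using (IsEquivalence)
open import Relation.Nullary using (¬_; Dec; yes; no)

-- Real numbers are Cauchy sequences of rationals up to Close, which says
-- that x m - y n → 0 as m and n tend to infinity independently.  This is a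
-- partial equivalence relation: x is Cauchy iff Close x x, and two
-- Cauchy sequences have the same limit iff they are Close.

Close : (x y : ℕ → ℚ) → Set
Close x y = ∀ ε → 0ℚ < ε →
  ∃ λ N → ∀ m n → N ℕ.≤ m → N ℕ.≤ n → ∣ x m ℚ.- y n ∣ < ε

private
  halves : ∀ ε → ½ ℚ.* ε ℚ.+ ½ ℚ.* ε ≡ ε
  halves ε = trans (sym (ℚₚ.*-distribʳ-+ ε ½ ½)) (ℚₚ.*-identityˡ ε)

  half>0 : ∀ {ε} → 0ℚ < ε → 0ℚ < ½ ℚ.* ε
  half>0 {ε} ε>0 =
    subst (_< ½ ℚ.* ε) (ℚₚ.*-zeroʳ ½) (ℚₚ.*-monoʳ-<-pos ½ ε>0)

  sum-small : ∀ {ε} p q r → p ≡ q ℚ.+ r →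
              ∣ q ∣ < ½ ℚ.* ε → ∣ r ∣ < ½ ℚ.* ε → ∣ p ∣ < ε
  sum-small {ε} p q r refl q< r< =
    ℚₚ.≤-<-trans (ℚₚ.∣p+q∣≤∣p∣+∣q∣ q r)
      (subst (∣ q ∣ ℚ.+ ∣ r ∣ <_) (halves ε) (ℚₚ.+-mono-< q< r<))

  ≤⊔ˡ : ∀ {k} m n → m ⊔ n ℕ.≤ k → m ℕ.≤ k
  ≤⊔ˡ m n = ℕₚ.m⊔n≤o⇒m≤o m n

  ≤⊔ʳ : ∀ {k} m n → m ⊔ n ℕ.≤ k → n ℕ.≤ k
  ≤⊔ʳ m n = ℕₚ.m⊔n≤o⇒n≤o m n

Close-sym : ∀ {x y} → Close x y → Close y x
Close-sym {x} {y} c ε ε>0 with c ε ε>0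
... | N , h = N , λ m n N≤m N≤n → subst (_< ε) (flip (x n) (y m)) (h n m N≤n N≤m)
  where
  open +-*-Solver
  flip : ∀ a b → ∣ a ℚ.- b ∣ ≡ ∣ b ℚ.- a ∣
  flip a b = trans (sym (ℚₚ.∣-p∣≡∣p∣ (a ℚ.- b)))
    (cong ∣_∣ (solve 2 (λ a b → :- (a :- b) := b :- a) refl a b))

Close-trans : ∀ {x y z} → Close x y → Close y z → Close x z
Close-trans {x} {y} {z} c d ε ε>0
  with c (½ ℚ.* ε) (half>0 ε>0) | d (½ ℚ.* ε) (half>0 ε>0)
... | M , h | N , k = M ⊔ N , λ m n ≤m ≤n →
  sum-small (x m ℚ.- z n) (x m ℚ.- y (M ⊔ N)) (y (M ⊔ N) ℚ.- z n)
    (solve 3 (λ a b c → a :- c := (a :- b) :+ (b :- c)) refl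
       (x m) (y (M ⊔ N)) (z n))
    (h m (M ⊔ N) (≤⊔ˡ M N ≤m) (ℕₚ.m≤m⊔n M N))
    (k (M ⊔ N) n (ℕₚ.m≤n⊔m M N) (≤⊔ʳ M N ≤n))
  where open +-*-Solver

Close-pointwise : ∀ {x y} → Close x x → (∀ n → x n ≡ y n) → Close x y
Close-pointwise {x} c x≗y ε ε>0 with c ε ε>0
... | N , h = N , λ m n N≤m N≤n →
  subst (λ q → ∣ x m ℚ.- q ∣ < ε) (x≗y n) (h m n N≤m N≤n)

Close-const : ∀ q → Close (λ _ → q) (λ _ → q)
Close-const q ε ε>0 = 0 , λ _ _ _ _ →
  subst (λ r → ∣ r ∣ < ε) (sym (ℚₚ.+-inverseʳ q)) ε>0

Close-+ : ∀ {x x′ y y′} → Close x x′ → Close y y′ →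
          Close (λ n → x n ℚ.+ y n) (λ n → x′ n ℚ.+ y′ n)
Close-+ {x} {x′} {y} {y′} c d ε ε>0
  with c (½ ℚ.* ε) (half>0 ε>0) | d (½ ℚ.* ε) (half>0 ε>0)
... | M , h | N , k = M ⊔ N , λ m n ≤m ≤n →
  sum-small _ (x m ℚ.- x′ n) (y m ℚ.- y′ n)
    (solve 4 (λ a b c d → (a :+ b) :- (c :+ d) := (a :- c) :+ (b :- d)) refl
       (x m) (y m) (x′ n) (y′ n))
    (h m n (≤⊔ˡ M N ≤m) (≤⊔ˡ M N ≤n))
    (k m n (≤⊔ʳ M N ≤m) (≤⊔ʳ M N ≤n))
  where open +-*-Solver

Close-neg : ∀ {x y} → Close x y → Close (ℚ.-_ ∘ x) (ℚ.-_ ∘ y)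
Close-neg {x} {y} c ε ε>0 with c ε ε>0
... | N , h = N , λ m n N≤m N≤n → subst (_< ε) (lem (x m) (y n)) (h m n N≤m N≤n)
  where
  open +-*-Solver
  lem : ∀ a b → ∣ a ℚ.- b ∣ ≡ ∣ ℚ.- a ℚ.- ℚ.- b ∣
  lem a b = trans (sym (ℚₚ.∣-p∣≡∣p∣ (a ℚ.- b)))
    (cong ∣_∣ (solve 2 (λ a b → :- (a :- b) := :- a :- :- b) refl a b))

private
  EventuallyBounded : (ℕ → ℚ) → Set
  EventuallyBounded x =
    ∃ λ B → Positive B × ∃ λ N → ∀ n → N ℕ.≤ n → ∣ x n ∣ ≤ B

  bounded : ∀ {x y} → Close x y → EventuallyBounded x
  bounded {x} {y} c with c 1ℚ (ℚₚ.positive⁻¹ 1ℚ)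
  ... | N , h =
    ∣ y N ∣ ℚ.+ 1ℚ
    , ℚₚ.nonNeg+pos⇒pos ∣ y N ∣ {{ℚₚ.∣-∣-nonNeg (y N)}} 1ℚ
    , N , λ n N≤n →
      subst (λ q → ∣ q ∣ ≤ ∣ y N ∣ ℚ.+ 1ℚ)
        (solve 2 (λ a b → b :+ (a :- b) := a) refl (x n) (y N))
        (ℚₚ.≤-trans (ℚₚ.∣p+q∣≤∣p∣+∣q∣ (y N) (x n ℚ.- y N))
          (ℚₚ.+-monoʳ-≤ ∣ y N ∣ (ℚₚ.<⇒≤ (h n N N≤n ℕₚ.≤-refl))))
    where open +-*-Solver

  product-small : ∀ B .{{_ : Positive B}} ε → 0ℚ < ε →
    ∃ λ η → 0ℚ < η × (∀ p q → ∣ p ∣ ≤ B → ∣ q ∣ < η → ∣ p ℚ.* q ∣ < ε)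
  product-small B ε ε>0 =
    1/ B ℚ.* ε
    , subst (_< 1/ B ℚ.* ε) (ℚₚ.*-zeroʳ (1/ B))
        (ℚₚ.*-monoʳ-<-pos (1/ B) {{ℚₚ.1/pos⇒pos B}} ε>0)
    , λ p q p≤ q< → subst (_< ε) (sym (ℚₚ.∣p*q∣≡∣p∣*∣q∣ p q))
        (ℚₚ.≤-<-trans
          (ℚₚ.*-monoʳ-≤-nonNeg ∣ q ∣ {{ℚₚ.∣-∣-nonNeg q}} p≤)
          (subst (B ℚ.* ∣ q ∣ <_) B/B*ε≡ε (ℚₚ.*-monoʳ-<-pos B q<)))
    where
    instance B≢0 = ℚₚ.pos⇒nonZero B
    B/B*ε≡ε : B ℚ.* (1/ B ℚ.* ε) ≡ ε
    B/B*ε≡ε = trans (sym (ℚₚ.*-assoc B (1/ B) ε))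
      (trans (cong (ℚ._* ε) (ℚₚ.*-inverseʳ B)) (ℚₚ.*-identityˡ ε))

Close-* : ∀ {x x′ y y′} → Close x x′ → Close y y′ →
          Close (λ n → x n ℚ.* y n) (λ n → x′ n ℚ.* y′ n)
Close-* {x} {x′} {y} {y′} c d ε ε>0 =
  choose-η (bounded {x} {x′} c) (bounded {y′} {y} (Close-sym {y} {y′} d))
  where
  Small : ℚ → ℚ → Set
  Small B η = ∀ p q → ∣ p ∣ ≤ B → ∣ q ∣ < η → ∣ p ℚ.* q ∣ < ½ ℚ.* ε

  split : ∀ a b c d →
          a ℚ.* b ℚ.- c ℚ.* d ≡ a ℚ.* (b ℚ.- d) ℚ.+ d ℚ.* (a ℚ.- c)
  split = solve 4
    (λ a b c d → a :* b :- c :* d := a :* (b :- d) :+ d :* (a :- c)) refl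
    where open +-*-Solver

  Conclusion : Set
  Conclusion = ∃ λ N → ∀ m n → N ℕ.≤ m → N ℕ.≤ n →
    ∣ x m ℚ.* y m ℚ.- x′ n ℚ.* y′ n ∣ < ε

  combine : ∀ {B C η θ K L} → Small B η → Small C θ →
            (∀ n → K ℕ.≤ n → ∣ x n ∣ ≤ B) →
            (∀ n → L ℕ.≤ n → ∣ y′ n ∣ ≤ C) →
            (∃ λ M → ∀ m n → M ℕ.≤ m → M ℕ.≤ n → ∣ x m ℚ.- x′ n ∣ < θ) →
            (∃ λ N → ∀ m n → N ℕ.≤ m → N ℕ.≤ n → ∣ y m ℚ.- y′ n ∣ < η) →
            Conclusion
  combine {K = K} {L} small small′ x≤B y′≤C (M , h) (N , k) =
    (K ⊔ L) ⊔ (M ⊔ N) , λ m n ≤m ≤n →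
      sum-small (x m ℚ.* y m ℚ.- x′ n ℚ.* y′ n)
        (x m ℚ.* (y m ℚ.- y′ n)) (y′ n ℚ.* (x m ℚ.- x′ n))
        (split (x m) (y m) (x′ n) (y′ n))
        (small (x m) (y m ℚ.- y′ n)
          (x≤B m (≤⊔ˡ K L (≤⊔ˡ (K ⊔ L) (M ⊔ N) ≤m)))
          (k m n (≤⊔ʳ M N (≤⊔ʳ (K ⊔ L) (M ⊔ N) ≤m))
                 (≤⊔ʳ M N (≤⊔ʳ (K ⊔ L) (M ⊔ N) ≤n))))
        (small′ (y′ n) (x m ℚ.- x′ n)
          (y′≤C n (≤⊔ʳ K L (≤⊔ˡ (K ⊔ L) (M ⊔ N) ≤n)))
          (h m n (≤⊔ˡ M N (≤⊔ʳ (K ⊔ L) (M ⊔ N) ≤m))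
                 (≤⊔ˡ M N (≤⊔ʳ (K ⊔ L) (M ⊔ N) ≤n))))

  choose-N : ∀ {B C K L} →
             (∃ λ η → 0ℚ < η × Small B η) → (∃ λ θ → 0ℚ < θ × Small C θ) →
             (∀ n → K ℕ.≤ n → ∣ x n ∣ ≤ B) →
             (∀ n → L ℕ.≤ n → ∣ y′ n ∣ ≤ C) → Conclusion
  choose-N (η , η>0 , small) (θ , θ>0 , small′) x≤B y′≤C =
    combine small small′ x≤B y′≤C (c θ θ>0) (d η η>0)

  choose-η : EventuallyBounded x → EventuallyBounded y′ → Conclusion
  choose-η (B , B>0 , K , x≤B) (C , C>0 , L , y′≤C) =
    choose-N (product-small B {{B>0}} (½ ℚ.* ε) (half>0 ε>0))
             (product-small C {{C>0}} (½ ℚ.* ε) (half>0 ε>0)) x≤B y′≤C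

record ℝ : Set where
  no-eta-equality
  field
    seq    : ℕ → ℚ
    cauchy : Close seq seq

open ℝ public

infix 4 _≈ℝ_
record _≈ℝ_ (x y : ℝ) : Set where
  constructor mk≈ℝ
  field
    close : Close (seq x) (seq y)

open _≈ℝ_ public

infixl 6 _+ℝ_ _-ℝ_
infixl 7 _*ℝ_
infix  8 -ℝ_

_+ℝ_ _*ℝ_ : ℝ → ℝ → ℝ

seq    (x +ℝ y) n = seq x n ℚ.+ seq y n
cauchy (x +ℝ y)   = Close-+ {seq x} {seq x} {seq y} {seq y} (cauchy x) (cauchy y)

seq    (x *ℝ y) n = seq x n ℚ.* seq y n
cauchy (x *ℝ y)   = Close-* {seq x} {seq x} {seq y} {seq y} (cauchy x) (cauchy y)

-ℝ_ : ℝ → ℝ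
seq    (-ℝ_ x) n = ℚ.- seq x n
cauchy (-ℝ_ x)   = Close-neg {seq x} {seq x} (cauchy x)

_-ℝ_ : ℝ → ℝ → ℝ
x -ℝ y = x +ℝ (-ℝ y)

fromℚ : ℚ → ℝ
seq    (fromℚ q) n = q
cauchy (fromℚ q)   = Close-const q

0ℝ 1ℝ : ℝ
0ℝ = fromℚ 0ℚ
1ℝ = fromℚ 1ℚ

≈ℝ-isEquivalence : IsEquivalence _≈ℝ_
≈ℝ-isEquivalence = record
  { refl  = λ {x} → mk≈ℝ (cauchy x)
  ; sym   = λ {x} {y} e → mk≈ℝ (Close-sym {seq x} {seq y} (close e))
  ; trans = λ {x} {y} {z} e f →
      mk≈ℝ (Close-trans {seq x} {seq y} {seq z} (close e) (close f))
  }

+ℝ-cong : ∀ {x x′ y y′} → x ≈ℝ x′ → y ≈ℝ y′ → x +ℝ y ≈ℝ x′ +ℝ y′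
+ℝ-cong {x} {x′} {y} {y′} e f =
  mk≈ℝ (Close-+ {seq x} {seq x′} {seq y} {seq y′} (close e) (close f))

*ℝ-cong : ∀ {x x′ y y′} → x ≈ℝ x′ → y ≈ℝ y′ → x *ℝ y ≈ℝ x′ *ℝ y′
*ℝ-cong {x} {x′} {y} {y′} e f =
  mk≈ℝ (Close-* {seq x} {seq x′} {seq y} {seq y′} (close e) (close f))

-ℝ-cong : ∀ {x y} → x ≈ℝ y → -ℝ x ≈ℝ -ℝ y
-ℝ-cong {x} {y} e = mk≈ℝ (Close-neg {seq x} {seq y} (close e))

pointwise : ∀ {x y} → (∀ n → seq x n ≡ seq y n) → x ≈ℝ y
pointwise {x} {y} h = mk≈ℝ (Close-pointwise {seq x} {seq y} (cauchy x) h)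

record ℂ : Set where
  no-eta-equality
  field
    re im : ℝ

open ℂ public

infix 4 _≈ℂ_
record _≈ℂ_ (z w : ℂ) : Set where
  constructor mk≈ℂ
  field
    re-≈ : re z ≈ℝ re w
    im-≈ : im z ≈ℝ im w

open _≈ℂ_ public

infixl 6 _+ℂ_
infixl 7 _*ℂ_
infix  8 -ℂ_

_+ℂ_ _*ℂ_ : ℂ → ℂ → ℂ

re (z +ℂ w) = re z +ℝ re w
im (z +ℂ w) = im z +ℝ im w

re (z *ℂ w) = re z *ℝ re w -ℝ im z *ℝ im w
im (z *ℂ w) = re z *ℝ im w +ℝ im z *ℝ re w

-ℂ_ : ℂ → ℂ
re (-ℂ_ z) = -ℝ re z
im (-ℂ_ z) = -ℝ im z

0ℂ 1ℂ : ℂ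

re 0ℂ = 0ℝ
im 0ℂ = 0ℝ

re 1ℂ = 1ℝ
im 1ℂ = 0ℝ

private
  module ℝ≈ = IsEquivalence ≈ℝ-isEquivalence

  pointwiseℂ : ∀ {z w} → (∀ n → seq (re z) n ≡ seq (re w) n) →
               (∀ n → seq (im z) n ≡ seq (im w) n) → z ≈ℂ w
  pointwiseℂ h k = mk≈ℂ (pointwise h) (pointwise k)

≈ℂ-isEquivalence : IsEquivalence _≈ℂ_
≈ℂ-isEquivalence = record
  { refl  = mk≈ℂ ℝ≈.refl ℝ≈.refl
  ; sym   = λ e → mk≈ℂ (ℝ≈.sym (re-≈ e)) (ℝ≈.sym (im-≈ e))
  ; trans = λ e f → mk≈ℂ (ℝ≈.trans (re-≈ e) (re-≈ f))
                         (ℝ≈.trans (im-≈ e) (im-≈ f))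
  }

ℂ-setoid : Setoid 0ℓ 0ℓ
ℂ-setoid = record { isEquivalence = ≈ℂ-isEquivalence }

private
  module ComplexIdentities where
    open Data.Rational.Base using (_+_; _*_; _-_)
    open +-*-Solver

    assoc-re : ∀ a b c d e f →
      (a * c - b * d) * e - (a * d + b * c) * f
      ≡ a * (c * e - d * f) - b * (c * f + d * e)
    assoc-re = solve 6 (λ a b c d e f →
      (a :* c :- b :* d) :* e :- (a :* d :+ b :* c) :* f
      := a :* (c :* e :- d :* f) :- b :* (c :* f :+ d :* e)) refl

    assoc-im : ∀ a b c d e f →
      (a * c - b * d) * f + (a * d + b * c) * e
      ≡ a * (c * f + d * e) + b * (c * e - d * f)
    assoc-im = solve 6 (λ a b c d e f →
      (a :* c :- b :* d) :* f :+ (a :* d :+ b :* c) :* e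
      := a :* (c :* f :+ d :* e) :+ b :* (c :* e :- d :* f)) refl

    identity-re : ∀ a b → 1ℚ * a - 0ℚ * b ≡ a
    identity-re = solve 2 (λ a b → con 1ℚ :* a :- con 0ℚ :* b := a) refl

    identity-im : ∀ a b → 1ℚ * b + 0ℚ * a ≡ b
    identity-im = solve 2 (λ a b → con 1ℚ :* b :+ con 0ℚ :* a := b) refl

    distribˡ-re : ∀ a b c d e f →
      a * (c + e) - b * (d + f) ≡ (a * c - b * d) + (a * e - b * f)
    distribˡ-re = solve 6 (λ a b c d e f →
      a :* (c :+ e) :- b :* (d :+ f)
      := (a :* c :- b :* d) :+ (a :* e :- b :* f)) refl

    distribˡ-im : ∀ a b c d e f →
      a * (d + f) + b * (c + e) ≡ (a * d + b * c) + (a * f + b * e)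
    distribˡ-im = solve 6 (λ a b c d e f →
      a :* (d :+ f) :+ b :* (c :+ e)
      := (a :* d :+ b :* c) :+ (a :* f :+ b :* e)) refl

    comm-re : ∀ a b c d → a * c - b * d ≡ c * a - d * b
    comm-re = solve 4 (λ a b c d → a :* c :- b :* d := c :* a :- d :* b) refl

    comm-im : ∀ a b c d → a * d + b * c ≡ c * b + d * a
    comm-im = solve 4 (λ a b c d → a :* d :+ b :* c := c :* b :+ d :* a) refl

  module ℂI = ComplexIdentities

  Re Im : ℂ → ℕ → ℚ
  Re z = seq (re z)
  Im z = seq (im z)

  +ℂ-cong : ∀ {z z′ w w′} → z ≈ℂ z′ → w ≈ℂ w′ → z +ℂ w ≈ℂ z′ +ℂ w′
  +ℂ-cong e f = mk≈ℂ (+ℝ-cong (re-≈ e) (re-≈ f)) (+ℝ-cong (im-≈ e) (im-≈ f))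

  *ℂ-assoc : ∀ z w v → (z *ℂ w) *ℂ v ≈ℂ z *ℂ (w *ℂ v)
  *ℂ-assoc z w v = pointwiseℂ
    (λ n → ℂI.assoc-re (Re z n) (Im z n) (Re w n) (Im w n) (Re v n) (Im v n))
    (λ n → ℂI.assoc-im (Re z n) (Im z n) (Re w n) (Im w n) (Re v n) (Im v n))

  *ℂ-identityˡ : ∀ z → 1ℂ *ℂ z ≈ℂ z
  *ℂ-identityˡ z = pointwiseℂ (λ n → ℂI.identity-re (Re z n) (Im z n))
                              (λ n → ℂI.identity-im (Re z n) (Im z n))

  *ℂ-distribˡ-+ℂ : ∀ z w v → z *ℂ (w +ℂ v) ≈ℂ z *ℂ w +ℂ z *ℂ v
  *ℂ-distribˡ-+ℂ z w v = pointwiseℂ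
    (λ n → ℂI.distribˡ-re (Re z n) (Im z n) (Re w n) (Im w n) (Re v n) (Im v n))
    (λ n → ℂI.distribˡ-im (Re z n) (Im z n) (Re w n) (Im w n) (Re v n) (Im v n))

  *ℂ-comm : ∀ z w → z *ℂ w ≈ℂ w *ℂ z
  *ℂ-comm z w = pointwiseℂ
    (λ n → ℂI.comm-re (Re z n) (Im z n) (Re w n) (Im w n))
    (λ n → ℂI.comm-im (Re z n) (Im z n) (Re w n) (Im w n))

  +ℂ-assoc : ∀ z w v → (z +ℂ w) +ℂ v ≈ℂ z +ℂ (w +ℂ v)
  +ℂ-assoc z w v = pointwiseℂ (λ n → ℚₚ.+-assoc (Re z n) (Re w n) (Re v n))
                              (λ n → ℚₚ.+-assoc (Im z n) (Im w n) (Im v n))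

  +ℂ-comm : ∀ z w → z +ℂ w ≈ℂ w +ℂ z
  +ℂ-comm z w = pointwiseℂ (λ n → ℚₚ.+-comm (Re z n) (Re w n))
                           (λ n → ℚₚ.+-comm (Im z n) (Im w n))

  +ℂ-identityˡ : ∀ z → 0ℂ +ℂ z ≈ℂ z
  +ℂ-identityˡ z = pointwiseℂ (λ n → ℚₚ.+-identityˡ (Re z n))
                              (λ n → ℚₚ.+-identityˡ (Im z n))

  -ℂ-inverseˡ : ∀ z → (-ℂ z) +ℂ z ≈ℂ 0ℂ
  -ℂ-inverseˡ z = pointwiseℂ (λ n → ℚₚ.+-inverseˡ (Re z n))
                             (λ n → ℚₚ.+-inverseˡ (Im z n))

  -ℂ-cong : ∀ {z w} → z ≈ℂ w → -ℂ z ≈ℂ -ℂ w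
  -ℂ-cong e = mk≈ℂ (-ℝ-cong (re-≈ e)) (-ℝ-cong (im-≈ e))

  *ℂ-cong : ∀ {z z′ w w′} → z ≈ℂ z′ → w ≈ℂ w′ → z *ℂ w ≈ℂ z′ *ℂ w′
  *ℂ-cong e f = mk≈ℂ
    (+ℝ-cong (*ℝ-cong (re-≈ e) (re-≈ f)) (-ℝ-cong (*ℝ-cong (im-≈ e) (im-≈ f))))
    (+ℝ-cong (*ℝ-cong (re-≈ e) (im-≈ f)) (*ℝ-cong (im-≈ e) (re-≈ f)))

ℂ-isCommutativeRing : IsCommutativeRing _≈ℂ_ _+ℂ_ _*ℂ_ -ℂ_ 0ℂ 1ℂ
ℂ-isCommutativeRing = record
  { isRing = record
    { +-isAbelianGroup = record
      { isGroup = record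
        { isMonoid = record
          { isSemigroup = record
            { isMagma = record
              { isEquivalence = ≈ℂ-isEquivalence
              ; ∙-cong        = +ℂ-cong
              }
            ; assoc = +ℂ-assoc
            }
          ; identity = comm∧idˡ⇒id +ℂ-comm +ℂ-identityˡ
          }
        ; inverse = comm∧invˡ⇒inv +ℂ-comm -ℂ-inverseˡ
        ; ⁻¹-cong = -ℂ-cong
        }
      ; comm = +ℂ-comm
      }
    ; *-cong     = *ℂ-cong
    ; *-assoc    = *ℂ-assoc
    ; *-identity = comm∧idˡ⇒id *ℂ-comm *ℂ-identityˡ
    ; distrib    = comm∧distrˡ⇒distr +ℂ-cong *ℂ-comm *ℂ-distribˡ-+ℂ
    }
  ; *-comm = *ℂ-comm
  }
  where
  open import Algebra.Consequences.Setoid ℂ-setoid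
    using (comm∧idˡ⇒id; comm∧invˡ⇒inv; comm∧distrˡ⇒distr)

ℂ-commutativeRing : CommutativeRing 0ℓ 0ℓ
ℂ-commutativeRing = record { isCommutativeRing = ℂ-isCommutativeRing }

open CommutativeRing ℂ-commutativeRing public
  using (_≈_; _≉_; _+_; _*_; 0#; 1#)
open import Algebra.Definitions.RawSemiring
  (Semiring.rawSemiring (CommutativeRing.semiring ℂ-commutativeRing)) public
  using (_^_; sum; product) renaming (_×_ to _·_)

Arithmetic : Set
Arithmetic = ∀ n → .{{ℕ.NonZero n}} → ℂ

record Multiplicative (α : Arithmetic) : Set where
  field
    nonvanishing : ¬ (∀ n → .{{_ : ℕ.NonZero n}} → α n ≈ 0#)
    homo         : ∀ m n .{{_ : ℕ.NonZero m}} .{{_ : ℕ.NonZero n}} →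
                   gcd m n ≡ 1 → α (m ℕ.* n) {{ℕₚ.m*n≢0 m n}} ≈ α m * α n

record CompletelyMultiplicative (α : Arithmetic) : Set where
  field
    nonvanishing : ¬ (∀ n → .{{_ : ℕ.NonZero n}} → α n ≈ 0#)
    homo         : ∀ m n .{{_ : ℕ.NonZero m}} .{{_ : ℕ.NonZero n}} →
                   α (m ℕ.* n) {{ℕₚ.m*n≢0 m n}} ≈ α m * α n

convolutionTerm : Arithmetic → Arithmetic →
                  ∀ n d .{{_ : ℕ.NonZero n}} .{{_ : ℕ.NonZero d}} →
                  Dec (d ∣ n) → ℂ
convolutionTerm α β n d (yes d∣n) =
  α d * β (quotient d∣n) {{quotient≢0 d∣n}}
convolutionTerm α β n d (no _)    = 0#

infixr 7 _⋆_
_⋆_ : Arithmetic → Arithmetic → Arithmetic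
(α ⋆ β) n = sum {n} λ i →
  convolutionTerm α β n (suc (toℕ i)) (suc (toℕ i) ∣? n)

δ : Arithmetic
δ 1 = 1#
δ _ = 0#

convolutionProduct : ∀ {r} → Vector Arithmetic r → Arithmetic
convolutionProduct = Vector.foldr _⋆_ δ

∏! : ∀ {n} → Vec ℕ n → ℕ
∏! []      = 1
∏! (k ∷ a) = k ! ℕ.* ∏! a

∏!≢0 : ∀ {n} (a : Vec ℕ n) → ℕ.NonZero (∏! a)
∏!≢0 []      = _
∏!≢0 (k ∷ a) = ℕₚ.m*n≢0 (k !) (∏! a) {{ℕₚ._!≢0 k}} {{∏!≢0 a}}

multinomial : ∀ {n} → Vec ℕ n → ℕ
multinomial a = (Vec.sum a ! ℕ./ ∏! a) {{∏!≢0 a}}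

-- (a₁, …, aₙ) ↦ Σⱼ j aⱼ
weight : ∀ {n} → Vec ℕ n → ℕ
weight a = Vec.sum (Vec.tabulate λ i → suc (toℕ i) ℕ.* lookup a i)

boundedTuples : ∀ n → ℕ → List (Vec ℕ n)
boundedTuples zero    b = [] ∷ []
boundedTuples (suc n) b =
  cartesianProductWith _∷_ (upTo (suc b)) (boundedTuples n b)

-- All a ∈ ℕⁿ of weight n; the entries of such a tuple are at most n.
tuplesOfWeight : ∀ n → List (Vec ℕ n)
tuplesOfWeight n = filter (λ a → weight a ℕₚ.≟ n) (boundedTuples n n)

monomial : ∀ {n} → Vector ℂ n → Vec ℕ n → ℂ
monomial t a = product (λ i → t i ^ lookup a i)

F : ∀ n → Vector ℂ n → ℂ
F n t = List.foldr _+_ 0#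
  (List.map (λ a → multinomial a · monomial t a) (tuplesOfWeight n))

onPowers : Arithmetic → ∀ {p} → Prime p → ℕ → ℂ
onPowers α {p} p-prime n =
  α (p ℕ.^ n) {{ℕₚ.m^n≢0 p n {{prime⇒nonZero p-prime}}}}

-- Here t i stands for the parameter with index i + 1.
IsParameters : Arithmetic → ∀ {p} → Prime p → (t : ℕ → ℂ) → Set
IsParameters α p-prime t =
  ∀ n → F n (λ i → t (toℕ i)) ≈ onPowers α p-prime n

data Extent : Set where
  fin ∞ : Extent

EventuallyZero : (ℕ → ℂ) → Set
EventuallyZero f = ∃ λ N → ∀ n → N ℕ.≤ n → f n ≈ 0#

HasExtent : (ℕ → ℂ) → Extent → Set
HasExtent f fin = EventuallyZero f
HasExtent f ∞   = ¬ EventuallyZero f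

-- The parameters exist and are unique, so quantifying them existentially
-- amounts to speaking of "the" parameters.
HasType : (range domain : Extent) → Arithmetic → ∀ {p} → Prime p → Set
HasType range domain α p-prime =
  ∃ λ t → IsParameters α p-prime t
        × HasExtent (onPowers α p-prime) range
        × HasExtent t domain

Type₁ Type₂ Type₃ Type₄ : Arithmetic → ∀ {p} → Prime p → Set
Type₁ = HasType fin fin
Type₂ = HasType ∞   fin
Type₃ = HasType fin ∞
Type₄ = HasType ∞   ∞

IdentityAt : Arithmetic → ∀ {p} → Prime p → Set
IdentityAt α p-prime = ∀ n → 1 ℕ.≤ n → onPowers α p-prime n ≈ 0#

record DegreeOneAt {p} (p-prime : Prime p) (β : Arithmetic) : Set where
  field
    completelyMultiplicative : CompletelyMultiplicative β
    nonzero                  : β p {{prime⇒nonZero p-prime}} ≉ 0#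

PositiveAt : Arithmetic → ∀ {p} → Prime p → Set
PositiveAt α p-prime =
  ∃ λ r → 1 ℕ.≤ r × ∃ λ (β : Vector Arithmetic r) →
    (∀ i → DegreeOneAt p-prime (β i)) ×
    (∀ n → onPowers α p-prime n ≈ onPowers (convolutionProduct β) p-prime n)

-- A convolution at pⁿ only involves values at powers of p, so the last
-- condition says that, on powers of p, α is inverse to the product.
NegativeAt : Arithmetic → ∀ {p} → Prime p → Set
NegativeAt α p-prime =
  ∃ λ r → 1 ℕ.≤ r × ∃ λ (β : Vector Arithmetic r) →
    (∀ i → DegreeOneAt p-prime (β i)) ×
    (∀ n → onPowers (α ⋆ convolutionProduct β) p-prime n ≈ onPowers δ p-prime n)

{-# OPTIONS --safe #-}

-- The generating series of the generalized Fibonacci polynomials is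
-- 1 / (1 − t₁ x − t₂ x² − …), because a multinomial coefficient is the sum of
-- those obtained by lowering one entry.  So the parameters of α are read off
-- the inverse of ∑ α(pⁿ) xⁿ.  A product of r degree one functions has the
-- series 1 / ∏ (1 − bᵢ x), whose denominator is a polynomial of degree r.  All
-- claims then reduce to this: a polynomial of positive degree has no polynomial
-- inverse.  Although equality in ℂ is undecidable, it is ¬¬-stable, and a
-- product ≈ 0 with one factor ≉ 0 has its other factor ≈ 0; no inverses of
-- complex numbers are needed.
module Submission where

open import Defs
open import Algebra.Bundles using (CommutativeRing; Semiring)
open import Data.Fin.Base using (Fin; zero; suc; toℕ; fromℕ<; opposite)
import Data.Fin.Permutation as Perm
import Data.Fin.Properties as Finₚ
open import Data.List.Base as List
  using (List; []; _∷_; _++_; cartesianProductWith; filter; applyUpTo; upTo)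
open import Data.List.Relation.Unary.All as All using (All; []; _∷_)
import Data.List.Relation.Unary.All.Properties as Allₚ
open import Data.Nat.Base as ℕ using (ℕ; zero; suc; _∸_; _⊔_; _!; pred)
open import Data.Nat.Combinatorics using (k![n∸k]!∣n!)
open import Data.Nat.Divisibility
  using (_∣_; _∣?_; divides; quotient≢0; ∣1⇒≡1; ∣-trans; *-monoʳ-∣; ∣-refl)
import Data.Nat.DivMod as DivMod
open import Data.Nat.GCD using (gcd-zeroˡ)
open import Data.Nat.Induction using (<-rec)
open import Data.Nat.Primality
  using (Prime; prime⇒nonZero; prime⇒nonTrivial; euclidsLemma)
import Data.Nat.Properties as ℕₚ
open import Data.Nat.Tactic.RingSolver using (solve-∀)
open import Data.Product.Base using (∃; _×_; _,_)
open import Data.Rational.Base as ℚ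
  using (ℚ; 0ℚ; 1ℚ; ½; ∣_∣; _<_; _≤_; positive)
import Data.Rational.Properties as ℚₚ
open import Data.Rational.Solver using (module +-*-Solver)
open import Data.Sum.Base using (_⊎_; inj₁; inj₂)
open import Data.Vec.Base as Vec using (Vec; []; _∷_; lookup; _[_]%=_)
open import Data.Vec.Functional as Vector using (Vector)
open import Function.Base using (_∘_; id)
open import Function.Bundles using (_⇔_; mk⇔)
open import Level using (Level)
open import Relation.Binary.Definitions using (tri<; tri≈; tri>)
open import Relation.Binary.PropositionalEquality as ≡ using (_≡_; _≢_; subst)
open import Relation.Binary.Structures using (IsEquivalence)
open import Relation.Nullary using (¬_; Dec; yes; no; contradiction)

-- `F n` draws the number of variables, the bound on exponents and the weight all from `n`, so
-- consecutive polynomials are sums over different index sets and no recurrence between them is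
-- visible. `boxCoefficient` makes the three numbers independent; its value turns out not to depend
-- on the first two once they are large enough. The degree of a polynomial over ℂ cannot be
-- computed, since its top coefficient cannot be tested for zero. A bound beyond which a sequence
-- vanishes takes its place and is lowered one index at a time. Series are not inverted in general.
-- The inverse that yields the parameters is exhibited in each case: `one`, the denominator, or the
-- values of the convolution product itself. Constant term 1 then gives uniqueness of inverses by
-- cancellation.

private
  module ℝ≈ = IsEquivalence ≈ℝ-isEquivalence

-- Sums over lists in a semiring

module ListSum {c ℓ} (R : Semiring c ℓ) where
  private
    module R = Semiring R
    open R using (Carrier)
    variable
      a b : Level
      A : Set a
      B : Set b

  -- The shape is that of the sum in `F`, which is therefore an instance by definition.
  Σᴸ : List A → (A → Carrier) → Carrier
  Σᴸ xs f = List.foldr R._+_ R.0# (List.map f xs)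

  Σᴸ-cong-All : ∀ {xs} {f g : A → Carrier} →
                All (λ x → f x R.≈ g x) xs → Σᴸ xs f R.≈ Σᴸ xs g
  Σᴸ-cong-All []       = R.refl
  Σᴸ-cong-All (e ∷ es) = R.+-cong e (Σᴸ-cong-All es)

  Σᴸ-cong : ∀ xs {f g : A → Carrier} → (∀ x → f x R.≈ g x) → Σᴸ xs f R.≈ Σᴸ xs g
  Σᴸ-cong xs e = Σᴸ-cong-All (All.universal e xs)

  Σᴸ-zero : ∀ (xs : List A) → Σᴸ xs (λ _ → R.0#) R.≈ R.0#
  Σᴸ-zero []       = R.refl
  Σᴸ-zero (x ∷ xs) = R.trans (R.+-identityˡ _) (Σᴸ-zero xs)

  Σᴸ-++ : ∀ xs ys (f : A → Carrier) → Σᴸ (xs ++ ys) f R.≈ Σᴸ xs f R.+ Σᴸ ys f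
  Σᴸ-++ []       ys f = R.sym (R.+-identityˡ _)
  Σᴸ-++ (x ∷ xs) ys f =
    R.trans (R.+-congˡ (Σᴸ-++ xs ys f)) (R.sym (R.+-assoc _ _ _))

  Σᴸ-map : ∀ (g : A → B) xs f → Σᴸ (List.map g xs) f R.≈ Σᴸ xs (f ∘ g)
  Σᴸ-map g []       f = R.refl
  Σᴸ-map g (x ∷ xs) f = R.+-congˡ (Σᴸ-map g xs f)

  Σᴸ-+ : ∀ xs (f g : A → Carrier) →
         Σᴸ xs (λ x → f x R.+ g x) R.≈ Σᴸ xs f R.+ Σᴸ xs g
  Σᴸ-+ []       f g = R.sym (R.+-identityˡ _)
  Σᴸ-+ (x ∷ xs) f g = R.trans (R.+-congˡ (Σᴸ-+ xs f g)) (interchange _ _ _ _)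
    where
    open import Algebra.Properties.CommutativeSemigroup R.+-commutativeSemigroup
      using (interchange)

  Σᴸ-*ˡ : ∀ c xs (f : A → Carrier) → Σᴸ xs (λ x → c R.* f x) R.≈ c R.* Σᴸ xs f
  Σᴸ-*ˡ c []       f = R.sym (R.zeroʳ c)
  Σᴸ-*ˡ c (x ∷ xs) f =
    R.trans (R.+-congˡ (Σᴸ-*ˡ c xs f)) (R.sym (R.distribˡ c _ _))

  -- Trades the filter for a summand that is zero off `P`, so that the index list can become a full
  -- box and be summed coordinate by coordinate.
  Σᴸ-filter : ∀ {p} {P : A → Set p} (P? : ∀ x → Dec (P x)) xs f g →
              (∀ x → P x → f x R.≈ g x) → (∀ x → ¬ P x → R.0# R.≈ g x) →
              Σᴸ (filter P? xs) f R.≈ Σᴸ xs g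
  Σᴸ-filter P? []       f g _ _ = R.refl
  Σᴸ-filter P? (x ∷ xs) f g yes≈ no≈ with P? x
  ... | yes Px = R.+-cong (yes≈ x Px) (Σᴸ-filter P? xs f g yes≈ no≈)
  ... | no ¬Px = R.trans (Σᴸ-filter P? xs f g yes≈ no≈)
                   (R.trans (R.sym (R.+-identityˡ _)) (R.+-congʳ (no≈ x ¬Px)))

module ℕΣ = ListSum ℕₚ.+-*-semiring

-- Multinomial coefficients

inc : ∀ {k} → Fin k → Vec ℕ k → Vec ℕ k
inc i a = a [ i ]%= suc

decHead : ∀ {k} → Vec ℕ (suc k) → List (Fin (suc k) × Vec ℕ (suc k))
decHead (zero  ∷ a) = []
decHead (suc x ∷ a) = (zero , x ∷ a) ∷ []

underHead : ∀ {k} → ℕ → Fin k × Vec ℕ k → Fin (suc k) × Vec ℕ (suc k)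
underHead x (i , a) = suc i , x ∷ a

-- all (i , b) with inc i b ≡ a
predecessors : ∀ {k} → Vec ℕ k → List (Fin k × Vec ℕ k)
predecessors []      = []
predecessors (x ∷ a) = decHead (x ∷ a) ++ List.map (underHead x) (predecessors a)

-- Soundness of the list; its completeness is carried by the sums in `sum-predecessors` and
-- `Σ-predecessors`.
predecessors-inc : ∀ {k} (a : Vec ℕ k) →
                   All (λ (i , b) → a ≡ inc i b) (predecessors a)
predecessors-inc []      = []
predecessors-inc (x ∷ a) = Allₚ.++⁺ (head x)
  (Allₚ.map⁺ (All.map (≡.cong (x ∷_)) (predecessors-inc a)))
  where
  head : ∀ x → All (λ (i , b) → x ∷ a ≡ inc i b) (decHead (x ∷ a))
  head zero    = []
  head (suc x) = ≡.refl ∷ []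

-- `weight` is the case `suc ∘ toℕ`. Arbitrary coefficients let an induction on the tuple pass to
-- `c ∘ suc`.
weighted : ∀ {k} → (Fin k → ℕ) → Vec ℕ k → ℕ
weighted c a = Vec.sum (Vec.tabulate λ i → c i ℕ.* lookup a i)

weighted-inc : ∀ {k} (c : Fin k → ℕ) i a →
               weighted c (inc i a) ≡ c i ℕ.+ weighted c a
weighted-inc c zero    (x ∷ a) = ≡.trans
  (≡.cong (ℕ._+ weighted (c ∘ suc) a) (ℕₚ.*-suc (c zero) x)) (ℕₚ.+-assoc (c zero) _ _)
weighted-inc c (suc i) (x ∷ a) = ≡.trans
  (≡.cong (c zero ℕ.* x ℕ.+_) (weighted-inc (c ∘ suc) i a))
  (exchange (c zero ℕ.* x) (c (suc i)) (weighted (c ∘ suc) a))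
  where
  exchange : ∀ p q r → p ℕ.+ (q ℕ.+ r) ≡ q ℕ.+ (p ℕ.+ r)
  exchange = solve-∀

sum≡0⇒weighted≡0 : ∀ {k} (c : Fin k → ℕ) a → Vec.sum a ≡ 0 → weighted c a ≡ 0
sum≡0⇒weighted≡0 c []         _ = ≡.refl
sum≡0⇒weighted≡0 c (zero ∷ a) e rewrite ℕₚ.*-zeroʳ (c zero) =
  sum≡0⇒weighted≡0 (c ∘ suc) a e

sum-inc : ∀ {k} i (a : Vec ℕ k) → Vec.sum (inc i a) ≡ suc (Vec.sum a)
sum-inc zero    (x ∷ a) = ≡.refl
sum-inc (suc i) (x ∷ a) = ≡.trans (≡.cong (x ℕ.+_) (sum-inc i a)) (ℕₚ.+-suc x _)

∏!-inc : ∀ {k} i (a : Vec ℕ k) → ∏! (inc i a) ≡ suc (lookup a i) ℕ.* ∏! a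
∏!-inc zero    (x ∷ a) = ℕₚ.*-assoc (suc x) (x !) (∏! a)
∏!-inc (suc i) (x ∷ a) = ≡.trans (≡.cong (x ! ℕ.*_) (∏!-inc i a))
  (exchange (x !) (suc (lookup a i)) (∏! a))
  where
  exchange : ∀ p q r → p ℕ.* (q ℕ.* r) ≡ q ℕ.* (p ℕ.* r)
  exchange = solve-∀

-- Integrality of the binomial coefficients splits off one entry at a time.
∏!∣sum! : ∀ {k} (a : Vec ℕ k) → ∏! a ∣ Vec.sum a !
∏!∣sum! []      = ∣-refl
∏!∣sum! (x ∷ a) = ∣-trans (*-monoʳ-∣ (x !) (∏!∣sum! a))
  (≡.subst (λ m → x ! ℕ.* m ! ∣ (x ℕ.+ Vec.sum a) !) (ℕₚ.m+n∸m≡n x (Vec.sum a))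
    (k![n∸k]!∣n! (ℕₚ.m≤m+n x (Vec.sum a))))

-- The division in `multinomial` is exact, so identities can be proved after clearing denominators.
∏!*multinomial : ∀ {k} (a : Vec ℕ k) → ∏! a ℕ.* multinomial a ≡ Vec.sum a !
∏!*multinomial a = DivMod.m*[n/m]≡n {{∏!≢0 a}} (∏!∣sum! a)

-- Lowering a positive entry and adding one gives that entry back, while zero entries have no
-- predecessor and add nothing to the sum either.
sum-predecessors : ∀ {k} (a : Vec ℕ k) →
  ℕΣ.Σᴸ (predecessors a) (λ (i , b) → suc (lookup b i)) ≡ Vec.sum a
sum-predecessors []      = ≡.refl
sum-predecessors (x ∷ a) = ≡.trans (ℕΣ.Σᴸ-++ (decHead (x ∷ a)) _ _)
  (≡.cong₂ ℕ._+_ (head x)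
    (≡.trans (ℕΣ.Σᴸ-map (underHead x) (predecessors a) _) (sum-predecessors a)))
  where
  head : ∀ x → ℕΣ.Σᴸ (decHead (x ∷ a)) (λ (i , b) → suc (lookup b i)) ≡ x
  head zero    = ≡.refl
  head (suc x) = ℕₚ.+-identityʳ (suc x)

-- Both sides are multiplied by ∏! a, which turns the summand for (i , b)
-- into (m !) * aᵢ.
multinomial-recurrence : ∀ {k} (a : Vec ℕ k) → Vec.sum a ≢ 0 →
  ℕΣ.Σᴸ (predecessors a) (λ (i , b) → multinomial b) ≡ multinomial a
multinomial-recurrence a sum≢0 = go (Vec.sum a) ≡.refl
  where
  open ≡.≡-Reasoning

  scaled : ∀ {m} → Vec.sum a ≡ suc m → ∀ i b → a ≡ inc i b →
           ∏! a ℕ.* multinomial b ≡ m ! ℕ.* suc (lookup b i)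
  scaled {m} e i b ≡.refl = begin
    ∏! (inc i b) ℕ.* multinomial b
      ≡⟨ ≡.cong (ℕ._* multinomial b) (∏!-inc i b) ⟩
    suc (lookup b i) ℕ.* ∏! b ℕ.* multinomial b
      ≡⟨ ℕₚ.*-assoc (suc (lookup b i)) (∏! b) (multinomial b) ⟩
    suc (lookup b i) ℕ.* (∏! b ℕ.* multinomial b)
      ≡⟨ ≡.cong (suc (lookup b i) ℕ.*_) (∏!*multinomial b) ⟩
    suc (lookup b i) ℕ.* Vec.sum b !
      ≡⟨ ≡.cong (λ n → suc (lookup b i) ℕ.* n !)
           (ℕₚ.suc-injective (≡.trans (≡.sym (sum-inc i b)) e)) ⟩
    suc (lookup b i) ℕ.* m !
      ≡⟨ ℕₚ.*-comm (suc (lookup b i)) (m !) ⟩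
    m ! ℕ.* suc (lookup b i) ∎

  go : ∀ n → Vec.sum a ≡ n →
       ℕΣ.Σᴸ (predecessors a) (λ (i , b) → multinomial b) ≡ multinomial a
  go zero    e = contradiction e sum≢0
  go (suc m) e = ℕₚ.*-cancelˡ-≡ _ _ (∏! a) {{∏!≢0 a}} (begin
    ∏! a ℕ.* ℕΣ.Σᴸ (predecessors a) (λ (i , b) → multinomial b)
      ≡⟨ ℕΣ.Σᴸ-*ˡ (∏! a) (predecessors a) _ ⟨
    ℕΣ.Σᴸ (predecessors a) (λ (i , b) → ∏! a ℕ.* multinomial b)
      ≡⟨ ℕΣ.Σᴸ-cong-All (All.map (λ {(i , b)} → scaled e i b) (predecessors-inc a)) ⟩
    ℕΣ.Σᴸ (predecessors a) (λ (i , b) → m ! ℕ.* suc (lookup b i))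
      ≡⟨ ℕΣ.Σᴸ-*ˡ (m !) (predecessors a) _ ⟩
    m ! ℕ.* ℕΣ.Σᴸ (predecessors a) (λ (i , b) → suc (lookup b i))
      ≡⟨ ≡.cong (m ! ℕ.*_) (≡.trans (sum-predecessors a) e) ⟩
    m ! ℕ.* suc m
      ≡⟨ ℕₚ.*-comm (m !) (suc m) ⟩
    suc m !
      ≡⟨ ≡.cong _! e ⟨
    Vec.sum a !
      ≡⟨ ∏!*multinomial a ⟨
    ∏! a ℕ.* multinomial a ∎)

-- Equality of complex numbers

½*-positive : ∀ {ε} → 0ℚ < ε → 0ℚ < ½ ℚ.* ε
½*-positive {ε} ε>0 = subst (_< ½ ℚ.* ε) (ℚₚ.*-zeroʳ ½) (ℚₚ.*-monoʳ-<-pos ½ ε>0)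

½*-double : ∀ ε → ½ ℚ.* ε ℚ.+ ½ ℚ.* ε ≡ ε
½*-double ε = ≡.trans (≡.sym (ℚₚ.*-distribʳ-+ ε ½ ½)) (ℚₚ.*-identityˡ ε)

-- A family of negations, hence provable from any contradiction.
NotFarFromZero : ℝ → Set
NotFarFromZero x =
  ∀ θ → 0ℚ < θ → ∀ N → ¬ (∀ n → N ℕ.≤ n → θ ≤ ∣ seq x n ∣)

≈0-tail : ∀ {x} → x ≈ℝ 0ℝ → ∀ ε → 0ℚ < ε →
          ∃ λ N → ∀ n → N ℕ.≤ n → ∣ seq x n ∣ < ε
≈0-tail {x} x≈0 ε ε>0 with close x≈0 ε ε>0
... | N , h = N , λ n N≤n →
  subst (λ q → ∣ q ∣ < ε) (ℚₚ.+-identityʳ (seq x n)) (h n n N≤n N≤n)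

tail-≈0 : ∀ {x} → (∀ ε → 0ℚ < ε → ∃ λ N → ∀ n → N ℕ.≤ n → ∣ seq x n ∣ < ε) →
          x ≈ℝ 0ℝ
tail-≈0 {x} h = mk≈ℝ λ ε ε>0 → let (N , k) = h ε ε>0 in
  N , λ m n N≤m N≤n →
    subst (λ q → ∣ q ∣ < ε) (≡.sym (ℚₚ.+-identityʳ (seq x m))) (k m N≤m)

-- A Cauchy sequence is eventually below ε or eventually at least ε / 4,
-- which makes equality to zero a negative property.
notFar⇒≈0 : ∀ {x} → NotFarFromZero x → x ≈ℝ 0ℝ
notFar⇒≈0 {x} near = tail-≈0 {x} tail
  where
  tail : ∀ ε → 0ℚ < ε → ∃ λ N → ∀ n → N ℕ.≤ n → ∣ seq x n ∣ < ε
  -- The first modulus turns a value below ε / 2 at `K` into values below ε ever after; the second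
  -- turns a single later value below ε / 4 into one below ε / 2 at `K`.
  tail ε ε>0 with cauchy x (½ ℚ.* ε) (½*-positive ε>0)
                | cauchy x (½ ℚ.* (½ ℚ.* ε)) (½*-positive (½*-positive ε>0))
  ... | M , h | N , k = decide (∣ seq x K ∣ ℚₚ.<? ½ ℚ.* ε)
    where
    K = M ⊔ N
    η = ½ ℚ.* ε
    θ = ½ ℚ.* η

    step : ∀ {ζ} m n → ∣ seq x m ℚ.- seq x n ∣ < ½ ℚ.* ζ →
           ∣ seq x n ∣ < ½ ℚ.* ζ → ∣ seq x m ∣ < ζ
    step {ζ} m n d< n< = ℚₚ.≤-<-trans
      (subst (λ q → ∣ q ∣ ≤ ∣ seq x m ℚ.- seq x n ∣ ℚ.+ ∣ seq x n ∣)
        (solve 2 (λ a b → a :- b :+ b := a) ≡.refl (seq x m) (seq x n))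
        (ℚₚ.∣p+q∣≤∣p∣+∣q∣ (seq x m ℚ.- seq x n) (seq x n)))
      (subst (∣ seq x m ℚ.- seq x n ∣ ℚ.+ ∣ seq x n ∣ <_) (½*-double ζ)
        (ℚₚ.+-mono-< d< n<))
      where open +-*-Solver

    decide : Dec (∣ seq x K ∣ < η) →
             ∃ λ N → ∀ n → N ℕ.≤ n → ∣ seq x n ∣ < ε
    decide (yes K<) = K , λ n K≤n →
      step n K (h n K (ℕₚ.m⊔n≤o⇒m≤o M N K≤n) (ℕₚ.m≤m⊔n M N)) K<
    decide (no K≮) = contradiction far (near θ (½*-positive (½*-positive ε>0)) K)
      where
      far : ∀ n → K ℕ.≤ n → θ ≤ ∣ seq x n ∣
      far n K≤n = ℚₚ.≮⇒≥ λ n< → K≮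
        (step K n (k K n (ℕₚ.m≤n⊔m M N) (ℕₚ.m⊔n≤o⇒n≤o M N K≤n)) n<)

≈0-stableℝ : ∀ {x} → ¬ ¬ (x ≈ℝ 0ℝ) → x ≈ℝ 0ℝ
≈0-stableℝ {x} ¬x≉0 = notFar⇒≈0 λ θ θ>0 N far → ¬x≉0 λ x≈0 →
  let (M , h) = ≈0-tail x≈0 θ θ>0 in
  ℚₚ.<-irrefl ≡.refl (ℚₚ.<-≤-trans (h (M ⊔ N) (ℕₚ.m≤m⊔n M N))
                                    (far (M ⊔ N) (ℕₚ.m≤n⊔m M N)))

-- If `y` stayed at distance θ or more from zero, then a tail of the product below `ε * θ` would
-- force a tail of `x` below ε, for every ε, and `x` would be zero.
*ℝ-cancel-≉0 : ∀ {x y} → x *ℝ y ≈ℝ 0ℝ → ¬ (x ≈ℝ 0ℝ) → y ≈ℝ 0ℝ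
*ℝ-cancel-≉0 {x} {y} xy≈0 x≉0 = notFar⇒≈0 λ θ θ>0 N far →
  x≉0 (tail-≈0 {x} λ ε ε>0 →
    let (M , h) = ≈0-tail xy≈0 (ε ℚ.* θ)
                    (subst (_< ε ℚ.* θ) (ℚₚ.*-zeroʳ ε)
                      (ℚₚ.*-monoʳ-<-pos ε {{positive ε>0}} θ>0))
    in M ⊔ N , λ n ≤n → ℚₚ.≰⇒> λ ε≤ →
      ℚₚ.<-irrefl ≡.refl (ℚₚ.<-≤-trans
        (h n (ℕₚ.m⊔n≤o⇒m≤o M N ≤n))
        (subst (ε ℚ.* θ ≤_) (≡.sym (ℚₚ.∣p*q∣≡∣p∣*∣q∣ (seq x n) (seq y n)))
          (ℚₚ.≤-trans
            (ℚₚ.*-monoʳ-≤-nonNeg θ {{ℚ.nonNegative (ℚₚ.<⇒≤ θ>0)}} ε≤)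
            (ℚₚ.*-monoˡ-≤-nonNeg ∣ seq x n ∣ {{ℚₚ.∣-∣-nonNeg (seq x n)}}
              (far n (ℕₚ.m⊔n≤o⇒n≤o M N ≤n)))))))

private
  0≤q² : ∀ q → 0ℚ ≤ q ℚ.* q
  0≤q² q = subst (0ℚ ≤_) (≡.trans (ℚₚ.∣p*q∣≡∣p∣*∣q∣ q q) (square q)) (ℚₚ.0≤∣p∣ (q ℚ.* q))
    where
    square : ∀ q → ∣ q ∣ ℚ.* ∣ q ∣ ≡ q ℚ.* q
    square q with ℚₚ.∣p∣≡p∨∣p∣≡-p q
    ... | inj₁ eq rewrite eq = ≡.refl
    ... | inj₂ eq rewrite eq = solve 1 (λ q → :- q :* :- q := q :* q) ≡.refl q
      where open +-*-Solver

  ∣p∣²≤∣p²+q²∣ : ∀ p q → ∣ p ∣ ℚ.* ∣ p ∣ ≤ ∣ p ℚ.* p ℚ.+ q ℚ.* q ∣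
  ∣p∣²≤∣p²+q²∣ p q = subst (_≤ ∣ p ℚ.* p ℚ.+ q ℚ.* q ∣) (ℚₚ.∣p*q∣≡∣p∣*∣q∣ p p)
    (≡.subst₂ _≤_ (≡.sym (ℚₚ.0≤p⇒∣p∣≡p (0≤q² p)))
       (≡.sym (ℚₚ.0≤p⇒∣p∣≡p (ℚₚ.+-mono-≤ (0≤q² p) (0≤q² q))))
       (subst (_≤ p ℚ.* p ℚ.+ q ℚ.* q) (ℚₚ.+-identityʳ (p ℚ.* p))
         (ℚₚ.+-monoʳ-≤ (p ℚ.* p) (0≤q² q))))

sumOfSquares≈0⇒≈0 : ∀ {x} y → x *ℝ x +ℝ y *ℝ y ≈ℝ 0ℝ → x ≈ℝ 0ℝ
sumOfSquares≈0⇒≈0 {x} y e = tail-≈0 {x} λ ε ε>0 →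
  let instance ε-pos = positive ε>0
      (N , h) = ≈0-tail e (ε ℚ.* ε)
                  (subst (_< ε ℚ.* ε) (ℚₚ.*-zeroʳ ε) (ℚₚ.*-monoʳ-<-pos ε ε>0))
  in N , λ n N≤n → ℚₚ.≰⇒> λ ε≤ → ℚₚ.<-irrefl ≡.refl
    (ℚₚ.<-≤-trans (h n N≤n) (ℚₚ.≤-trans
      (ℚₚ.≤-trans
        (ℚₚ.*-monoʳ-≤-nonNeg ε {{ℚₚ.pos⇒nonNeg ε}} ε≤)
        (ℚₚ.*-monoˡ-≤-nonNeg ∣ seq x n ∣ {{ℚₚ.∣-∣-nonNeg (seq x n)}} ε≤))
      (∣p∣²≤∣p²+q²∣ (seq x n) (seq y n))))

-- The squared modulus is real, multiplicative and zero only at zero, so it transports cancellation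
-- from ℝ to ℂ.
∣_∣² : ℂ → ℝ
∣ z ∣² = re z *ℝ re z +ℝ im z *ℝ im z

∣∣²≈0⇒≈0 : ∀ {z} → ∣ z ∣² ≈ℝ 0ℝ → z ≈ 0#
∣∣²≈0⇒≈0 {z} e = mk≈ℂ (sumOfSquares≈0⇒≈0 (im z) e)
  (sumOfSquares≈0⇒≈0 (re z) (ℝ≈.trans
    (pointwise λ n → ℚₚ.+-comm (seq (im z *ℝ im z) n) (seq (re z *ℝ re z) n)) e))

≈0⇒∣∣²≈0 : ∀ {z} → z ≈ 0# → ∣ z ∣² ≈ℝ 0ℝ
≈0⇒∣∣²≈0 (mk≈ℂ e f) =
  ℝ≈.trans (+ℝ-cong (*ℝ-cong e e) (*ℝ-cong f f)) (pointwise λ _ → ≡.refl)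

-- The two-square identity, which holds exactly at every index of the rational sequences.
∣∣²-homo-* : ∀ z w → ∣ z ∣² *ℝ ∣ w ∣² ≈ℝ ∣ z * w ∣²
∣∣²-homo-* z w = pointwise λ n → solve 4
  (λ a b c d → (a :* a :+ b :* b) :* (c :* c :+ d :* d)
    := (a :* c :- b :* d) :* (a :* c :- b :* d)
       :+ (a :* d :+ b :* c) :* (a :* d :+ b :* c)) ≡.refl
  (seq (re z) n) (seq (im z) n) (seq (re w) n) (seq (im w) n)
  where open +-*-Solver

*-cancel-≉0 : ∀ {z w} → z * w ≈ 0# → z ≉ 0# → w ≈ 0#
*-cancel-≉0 {z} {w} zw≈0 z≉0 = ∣∣²≈0⇒≈0 (*ℝ-cancel-≉0
  (ℝ≈.trans (∣∣²-homo-* z w) (≈0⇒∣∣²≈0 zw≈0)) (λ e → z≉0 (∣∣²≈0⇒≈0 e)))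

≈0-stable : ∀ {z} → ¬ (z ≉ 0#) → z ≈ 0#
≈0-stable ¬z≉0 = mk≈ℂ (≈0-stableℝ λ k → ¬z≉0 λ e → k (re-≈ e))
                      (≈0-stableℝ λ k → ¬z≉0 λ e → k (im-≈ e))

1≉0 : 1# ≉ 0#
1≉0 e with close (re-≈ e) 1ℚ (ℚₚ.positive⁻¹ 1ℚ)
... | N , h = ℚₚ.<-irrefl ≡.refl (h N N ℕₚ.≤-refl ℕₚ.≤-refl)

open CommutativeRing ℂ-commutativeRing
  hiding (_≈_; _≉_; _+_; _*_; 0#; 1#; zero)
open import Algebra.Properties.Ring ring
open import Algebra.Properties.Semiring.Sum semiring hiding (sum)
open import Algebra.Properties.Semiring.Mult semiring
  using (×-congʳ; ×-homo-+; ×-comm-*; ×-homo-1)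
open import Relation.Binary.Reasoning.Setoid setoid
open ListSum semiring

-- Power series

sum-zero : ∀ {n} {f : Vector ℂ n} → (∀ i → f i ≈ 0#) → sum f ≈ 0#
sum-zero {n} f≈0 = trans (sum-cong-≋ f≈0) (sum-replicate-zero n)

sum-only : ∀ {n} (f : Vector ℂ n) i → (∀ j → j ≢ i → f j ≈ 0#) → sum f ≈ f i
sum-only {suc n} f i f≈0 = begin
  sum f                          ≈⟨ sum-remove {i = i} f ⟩
  f i + sum (Vector.removeAt f i) ≈⟨ +-congˡ (sum-zero λ j → f≈0 _ (Finₚ.punchInᵢ≢i i j)) ⟩
  f i + 0#                       ≈⟨ +-identityʳ (f i) ⟩
  f i                            ∎

Σ< : ℕ → (ℕ → ℂ) → ℂ
Σ< n f = sum {n} (f ∘ toℕ)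

Σ<-cong : ∀ n {f g : ℕ → ℂ} → (∀ i → i ℕ.< n → f i ≈ g i) → Σ< n f ≈ Σ< n g
Σ<-cong n f≈g = sum-cong-≋ λ i → f≈g (toℕ i) (Finₚ.toℕ<n i)

Σ<-+ : ∀ m n f → Σ< (m ℕ.+ n) f ≈ Σ< m f + Σ< n (λ i → f (m ℕ.+ i))
Σ<-+ zero    n f = sym (+-identityˡ _)
Σ<-+ (suc m) n f = trans (+-congˡ (Σ<-+ m n (f ∘ suc))) (sym (+-assoc _ _ _))

Σ<-last : ∀ n f → Σ< (suc n) f ≈ Σ< n f + f n
Σ<-last n f = begin
  Σ< (suc n) f                        ≡⟨ ≡.cong (λ k → Σ< k f) (ℕₚ.+-comm 1 n) ⟩
  Σ< (n ℕ.+ 1) f                      ≈⟨ Σ<-+ n 1 f ⟩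
  Σ< n f + (f (n ℕ.+ 0) + 0#)         ≈⟨ +-congˡ (+-identityʳ _) ⟩
  Σ< n f + f (n ℕ.+ 0)                ≡⟨ ≡.cong (λ k → Σ< n f + f k) (ℕₚ.+-identityʳ n) ⟩
  Σ< n f + f n                        ∎

Σ<-truncate : ∀ {m n} f → m ℕ.≤ n → (∀ i → m ℕ.≤ i → i ℕ.< n → f i ≈ 0#) →
              Σ< n f ≈ Σ< m f
Σ<-truncate {m} {n} f m≤n f≈0 = begin
  Σ< n f                                    ≡⟨ ≡.cong (λ k → Σ< k f) (ℕₚ.m+[n∸m]≡n m≤n) ⟨
  Σ< (m ℕ.+ (n ∸ m)) f                      ≈⟨ Σ<-+ m (n ∸ m) f ⟩
  Σ< m f + Σ< (n ∸ m) (λ i → f (m ℕ.+ i))   ≈⟨ +-congˡ (sum-zero {n ∸ m} λ i → f≈0 _ (ℕₚ.m≤m+n m (toℕ i)) (bound i)) ⟩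
  Σ< m f + 0#                               ≈⟨ +-identityʳ _ ⟩
  Σ< m f                                    ∎
  where
  bound : ∀ (i : Fin (n ∸ m)) → m ℕ.+ toℕ i ℕ.< n
  bound i = ≡.subst (m ℕ.+ toℕ i ℕ.<_) (ℕₚ.m+[n∸m]≡n m≤n) (ℕₚ.+-monoʳ-< m (Finₚ.toℕ<n i))

infixr 7 _⊛_
_⊛_ : (f g : ℕ → ℂ) → ℕ → ℂ
(f ⊛ g) n = Σ< (suc n) λ i → f i * g (n ∸ i)

infix 4 _≐_
_≐_ : (f g : ℕ → ℂ) → Set
f ≐ g = ∀ n → f n ≈ g n

⊛-cong : ∀ {f f′ g g′} → f ≐ f′ → g ≐ g′ → f ⊛ g ≐ f′ ⊛ g′
⊛-cong f≐f′ g≐g′ n = Σ<-cong (suc n) λ i _ → *-cong (f≐f′ i) (g≐g′ (n ∸ i))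

⊛-congˡ-≤ : ∀ f g h n → (∀ m → m ℕ.≤ n → g m ≈ h m) → (f ⊛ g) n ≈ (f ⊛ h) n
⊛-congˡ-≤ f g h n g≈h = sum-cong-≋ {suc n} λ i →
  *-congˡ {f (toℕ i)} (g≈h (n ∸ toℕ i) (ℕₚ.m∸n≤m n (toℕ i)))

-‿⊛ : ∀ f g n → ((-_ ∘ f) ⊛ g) n ≈ - (f ⊛ g) n
-‿⊛ f g n = begin
  ((-_ ∘ f) ⊛ g) n
    ≈⟨ sum-cong-≋ {suc n} (λ i → trans (*-congʳ (sym (-1*x≈-x (f (toℕ i)))))
                                       (*-assoc (- 1#) (f (toℕ i)) (g (n ∸ toℕ i)))) ⟩
  sum {suc n} (λ i → - 1# * (f (toℕ i) * g (n ∸ toℕ i)))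
    ≈⟨ *-distribˡ-sum {suc n} (- 1#) (λ i → f (toℕ i) * g (n ∸ toℕ i)) ⟨
  - 1# * (f ⊛ g) n
    ≈⟨ -1*x≈-x _ ⟩
  - (f ⊛ g) n ∎

⊛-comm : ∀ f g → f ⊛ g ≐ g ⊛ f
⊛-comm f g n = begin
  (f ⊛ g) n
    ≈⟨ sum-permute {suc n} {suc n} (λ i → f (toℕ i) * g (n ∸ toℕ i)) Perm.reverse ⟩
  sum {suc n} (λ i → f (toℕ (opposite i)) * g (n ∸ toℕ (opposite i)))
    ≈⟨ sum-cong-≋ {suc n} (λ i → flipped (toℕ i) (ℕₚ.≤-pred (Finₚ.toℕ<n i)) (Finₚ.opposite-prop i)) ⟩
  (g ⊛ f) n ∎
  where
  flipped : ∀ i {j} → i ℕ.≤ n → j ≡ n ∸ i → f j * g (n ∸ j) ≈ g i * f (n ∸ i)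
  flipped i i≤n ≡.refl = trans (*-comm _ _)
    (reflexive (≡.cong (λ k → g k * f (n ∸ i)) (ℕₚ.m∸[m∸n]≡n i≤n)))

one : ℕ → ℂ
one zero    = 1#
one (suc n) = 0#

shift : (ℕ → ℂ) → ℕ → ℂ
shift f zero    = 0#
shift f (suc n) = f n

-- multiplication by 1 + c x
linear : ℂ → (ℕ → ℂ) → ℕ → ℂ
linear c f n = f n + c * shift f n

shift-⊛ : ∀ f g → shift f ⊛ g ≐ shift (f ⊛ g)
shift-⊛ f g zero    = trans (+-identityʳ _) (zeroˡ _)
shift-⊛ f g (suc n) = trans (+-congʳ (zeroˡ _)) (+-identityˡ _)

linear-⊛ : ∀ c f g → linear c f ⊛ g ≐ linear c (f ⊛ g)
linear-⊛ c f g n = begin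
  (linear c f ⊛ g) n
    ≈⟨ sum-cong-≋ {suc n} (λ i → trans
         (distribʳ (v i) (f (toℕ i)) (c * shift f (toℕ i)))
         (+-congˡ (*-assoc c (shift f (toℕ i)) (v i)))) ⟩
  sum {suc n} (λ i → f (toℕ i) * v i + c * u i)
    ≈⟨ ∑-distrib-+ {suc n} (λ i → f (toℕ i) * v i) (λ i → c * u i) ⟩
  (f ⊛ g) n + sum {suc n} (λ i → c * u i)
    ≈⟨ +-congˡ (*-distribˡ-sum {suc n} c u) ⟨
  (f ⊛ g) n + c * (shift f ⊛ g) n
    ≈⟨ +-congˡ (*-congˡ (shift-⊛ f g n)) ⟩
  linear c (f ⊛ g) n ∎
  where
  v u : Vector ℂ (suc n)
  v i = g (n ∸ toℕ i)
  u i  = shift f (toℕ i) * v i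

shift-cong : ∀ {f g} → f ≐ g → shift f ≐ shift g
shift-cong f≐g zero    = refl
shift-cong f≐g (suc n) = f≐g n

linear-cong : ∀ c {f g} → f ≐ g → linear c f ≐ linear c g
linear-cong c f≐g n = +-cong (f≐g n) (*-congˡ (shift-cong f≐g n))

-- Lets a factor of the denominator cross the product and meet the geometric series that it cancels.
⊛-linear : ∀ c f g → f ⊛ linear c g ≐ linear c f ⊛ g
⊛-linear c f g n = begin
  (f ⊛ linear c g) n   ≈⟨ ⊛-comm f (linear c g) n ⟩
  (linear c g ⊛ f) n   ≈⟨ linear-⊛ c g f n ⟩
  linear c (g ⊛ f) n   ≈⟨ linear-cong c (⊛-comm g f) n ⟩
  linear c (f ⊛ g) n   ≈⟨ linear-⊛ c f g n ⟨
  (linear c f ⊛ g) n   ∎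

one-⊛ : ∀ f → one ⊛ f ≐ f
one-⊛ f n = begin
  1# * f n + sum {n} (λ i → 0# * f (n ∸ suc (toℕ i)))  ≈⟨ +-cong (*-identityˡ _) (sum-zero {n} λ i → zeroˡ _) ⟩
  f n + 0#                                         ≈⟨ +-identityʳ _ ⟩
  f n                                              ∎

geometric-⊛ : ∀ c f → linear (- c) ((c ^_) ⊛ f) ≐ f
geometric-⊛ c f n = begin
  linear (- c) ((c ^_) ⊛ f) n  ≈⟨ linear-⊛ (- c) (c ^_) f n ⟨
  (linear (- c) (c ^_) ⊛ f) n  ≈⟨ ⊛-cong {g = f} geometric (λ _ → refl) n ⟩
  (one ⊛ f) n                  ≈⟨ one-⊛ f n ⟩
  f n                          ∎
  where
  geometric : linear (- c) (c ^_) ≐ one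
  geometric zero    = trans (+-congˡ (zeroʳ _)) (+-identityʳ _)
  geometric (suc n) = trans (+-congˡ (sym (-‿distribˡ-* c _))) (-‿inverseʳ _)

-- Strong induction: coefficient `n` of the product is `g n` plus terms in earlier values of `g`.
-- Constant term 1 avoids division.
⊛-cancelˡ : ∀ {f g h} → f 0 ≈ 1# → f ⊛ g ≐ f ⊛ h → g ≐ h
⊛-cancelˡ {f} {g} {h} f₀≈1 fg≐fh = <-rec _ λ n rec → +-cancelʳ (tail g n) (g n) (h n) (begin
  g n + tail g n                ≈⟨ +-congʳ (*-identityˡ _) ⟨
  1# * g n + tail g n           ≈⟨ +-congʳ (*-congʳ f₀≈1) ⟨
  (f ⊛ g) n                     ≈⟨ fg≐fh n ⟩
  (f ⊛ h) n                     ≈⟨ +-cong (trans (*-congʳ f₀≈1) (*-identityˡ _)) (sum-cong-≋ {n} λ i →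
                                     *-congˡ {f (suc (toℕ i))} (sym (rec (∸-suc-< n i)))) ⟩
  h n + tail g n                ∎)
  where
  tail : (ℕ → ℂ) → ℕ → ℂ
  tail g n = sum {n} λ i → f (suc (toℕ i)) * g (n ∸ suc (toℕ i))

  ∸-suc-< : ∀ n (i : Fin n) → n ∸ suc (toℕ i) ℕ.< n
  ∸-suc-< (suc n) i = ℕ.s≤s (ℕₚ.m∸n≤m n (toℕ i))

-- Degrees and polynomial inverses

record HasDegree (f : ℕ → ℂ) (k : ℕ) : Set where
  field
    leading : f k ≉ 0#
    above   : ∀ n → k ℕ.< n → f n ≈ 0#

one-degree : HasDegree one 0
one-degree = record { leading = 1≉0 ; above = λ { (suc _) _ → refl } }

linear-degree : ∀ {c f k} → c ≉ 0# → HasDegree f k → HasDegree (linear c f) (suc k)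
linear-degree {c} {f} {k} c≉0 d = record
  { leading = λ e → leading (*-cancel-≉0 (begin
      c * f k                ≈⟨ +-identityˡ _ ⟨
      0# + c * f k           ≈⟨ +-congʳ (above (suc k) ℕₚ.≤-refl) ⟨
      linear c f (suc k)     ≈⟨ e ⟩
      0#                     ∎) c≉0)
  ; above   = λ { (suc n) (ℕ.s≤s k<n) → begin
      f (suc n) + c * f n    ≈⟨ +-cong (above (suc n) (ℕₚ.m<n⇒m<1+n k<n)) (*-congˡ (above n k<n)) ⟩
      0# + c * 0#            ≈⟨ trans (+-identityˡ _) (zeroʳ c) ⟩
      0#                     ∎ }
  }
  where open HasDegree d

-- If s vanished from N on, then the coefficient of a ⊛ s of index k + N − 1
-- would force s to vanish from N − 1 on as well, and so on down to s = 0.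
polynomial-inverse-infinite : ∀ {a s k} → 1 ℕ.≤ k → HasDegree a k →
                              a ⊛ s ≐ one → ¬ EventuallyZero s
polynomial-inverse-infinite {a} {s} {suc k} _ d as≐one (N , s≈0) = descend N s≈0
  where
  open HasDegree d

  descend : ∀ N → ¬ (∀ n → N ℕ.≤ n → s n ≈ 0#)
  descend zero s≈0 = 1≉0 (begin
    1#               ≈⟨ as≐one 0 ⟨
    a 0 * s 0 + 0#   ≈⟨ trans (+-identityʳ _) (*-congˡ (s≈0 0 ℕ.z≤n)) ⟩
    a 0 * 0#         ≈⟨ zeroʳ _ ⟩
    0#               ∎)
  descend (suc N) s≈0 = descend N λ n N≤n → case n N≤n (ℕₚ.m≤n⇒m<n∨m≡n N≤n)
    where
    m = suc k ℕ.+ N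

    k<1+m : suc k ℕ.< suc m
    k<1+m = ℕ.s≤s (ℕₚ.m≤m+n (suc k) N)

    term : Fin (suc m) → ℂ
    term i = a (toℕ i) * s (m ∸ toℕ i)

    others : ∀ i → i ≢ suc k → a i * s (m ∸ i) ≈ 0#
    others i i≢k with ℕₚ.<-cmp i (suc k)
    -- Below the degree, `m ∸ i` is at least `suc N`, where `s` is already known to vanish.
    ... | tri< i<k _ _ = trans (*-congˡ (s≈0 (m ∸ i) N<m∸i)) (zeroʳ _)
      where
      N<m∸i : suc N ℕ.≤ m ∸ i
      N<m∸i = ≡.subst (ℕ._≤ m ∸ i) (ℕₚ.m+n∸m≡n k (suc N))
        (≡.subst (λ l → k ℕ.+ suc N ∸ k ℕ.≤ l ∸ i) (ℕₚ.+-suc k N)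
          (ℕₚ.∸-monoʳ-≤ (k ℕ.+ suc N) (ℕₚ.≤-pred i<k)))
    ... | tri≈ _ i≡k _ = contradiction i≡k i≢k
    ... | tri> _ _ k<i = trans (*-congʳ (above i k<i)) (zeroˡ _)

    only : (a ⊛ s) m ≈ a (suc k) * s N
    only = begin
      (a ⊛ s) m      ≈⟨ sum-only term (fromℕ< k<1+m) (λ j j≢k → others (toℕ j)
                          λ e → j≢k (Finₚ.toℕ-injective (≡.trans e (≡.sym (Finₚ.toℕ-fromℕ< k<1+m))))) ⟩
      term (fromℕ< k<1+m)      ≡⟨ ≡.cong (λ i → a i * s (m ∸ i)) (Finₚ.toℕ-fromℕ< k<1+m) ⟩
      a (suc k) * s (m ∸ suc k) ≡⟨ ≡.cong (λ i → a (suc k) * s i) (ℕₚ.m+n∸m≡n (suc k) N) ⟩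
      a (suc k) * s N ∎

    case : ∀ n → N ℕ.≤ n → N ℕ.< n ⊎ N ≡ n → s n ≈ 0#
    case n _ (inj₁ N<n)    = s≈0 n N<n
    -- Positive degree makes `m` a successor, so `one m` is `0#`.
    case n _ (inj₂ ≡.refl) = *-cancel-≉0 (trans (sym only) (as≐one m)) leading

-- Generalized Fibonacci polynomials

monomial-inc : ∀ {k} (t : Vector ℂ k) i a →
               monomial t (inc i a) ≈ t i * monomial t a
monomial-inc t zero    (x ∷ a) = *-assoc _ _ _
monomial-inc t (suc i) (x ∷ a) =
  trans (*-congˡ (monomial-inc (t ∘ suc) i a)) (x∙yz≈y∙xz _ _ _)
  where
  open import Algebra.Properties.CommutativeSemigroup *-commutativeSemigroup
    using (x∙yz≈y∙xz)

Σᴸ-· : ∀ {A : Set} xs (f : A → ℕ) z →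
       Σᴸ xs (λ x → f x · z) ≈ ℕΣ.Σᴸ xs f · z
Σᴸ-· []       f z = refl
Σᴸ-· (x ∷ xs) f z = trans (+-congˡ (Σᴸ-· xs f z)) (sym (×-homo-+ z (f x) _))

Σᴸ-sum-comm : ∀ {A : Set} {n} xs (f : A → Fin n → ℂ) →
              Σᴸ xs (λ x → sum (f x)) ≈ sum (λ i → Σᴸ xs (λ x → f x i))
Σᴸ-sum-comm {n = n} []       f = sym (sum-zero {n} λ _ → refl)
Σᴸ-sum-comm {n = n} (x ∷ xs) f =
  trans (+-congˡ (Σᴸ-sum-comm xs f)) (sym (∑-distrib-+ {n} (f x) _))

Σᴸ-applyUpTo : ∀ {A : Set} (g : ℕ → A) n f → Σᴸ (applyUpTo g n) f ≈ Σ< n (f ∘ g)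
Σᴸ-applyUpTo g zero    f = refl
Σᴸ-applyUpTo g (suc n) f = +-congˡ (Σᴸ-applyUpTo (g ∘ suc) n f)

Σᴸ-cartesianProductWith : ∀ {A B C : Set} (h : A → B → C) xs ys f →
  Σᴸ (cartesianProductWith h xs ys) f ≈ Σᴸ xs λ x → Σᴸ ys λ y → f (h x y)
Σᴸ-cartesianProductWith h []       ys f = refl
Σᴸ-cartesianProductWith h (x ∷ xs) ys f = trans (Σᴸ-++ (List.map (h x) ys) _ f)
  (+-cong (Σᴸ-map (h x) ys f) (Σᴸ-cartesianProductWith h xs ys f))

Σ-box-suc : ∀ k b (f : Vec ℕ (suc k) → ℂ) →
  Σᴸ (boundedTuples (suc k) b) f ≈ Σ< (suc b) λ x → Σᴸ (boundedTuples k b) λ a → f (x ∷ a)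
Σ-box-suc k b f = trans
  (Σᴸ-cartesianProductWith _∷_ (upTo (suc b)) (boundedTuples k b) f)
  (Σᴸ-applyUpTo id (suc b) _)

-- Interchange of summation. The pairs `(i , c)` that occur on the left are those with `c` in the
-- box and entry `i` below `b`; on the right also entry `b` is allowed, and there the hypothesis
-- makes `g` vanish.
Σ-predecessors : ∀ k b (g : Fin k → Vec ℕ k → ℂ) →
  (∀ i a → lookup a i ≡ b → g i a ≈ 0#) →
  Σᴸ (boundedTuples k b) (λ a → Σᴸ (predecessors a) λ (i , c) → g i c)
  ≈ sum λ i → Σᴸ (boundedTuples k b) (g i)
Σ-predecessors zero    b g _   = +-identityˡ 0#
Σ-predecessors (suc k) b g g≈0 = begin
  Σᴸ (boundedTuples (suc k) b) (λ a → Σᴸ (predecessors a) g′)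
    ≈⟨ Σ-box-suc k b _ ⟩
  Σ< (suc b) (λ x → Σᴸ box λ a → Σᴸ (predecessors (x ∷ a)) g′)
    ≈⟨ Σ<-cong (suc b) (λ x _ → slice x) ⟩
  Σ< (suc b) (λ x → heads x + sum λ i → tails i x)
    ≈⟨ ∑-distrib-+ {suc b} (heads ∘ toℕ) (λ x → sum λ i → tails i (toℕ x)) ⟩
  Σ< (suc b) heads + Σ< (suc b) (λ x → sum λ i → tails i x)
    ≈⟨ +-cong all-heads (∑-comm {suc b} {k} λ x i → tails i (toℕ x)) ⟩
  Σᴸ (boundedTuples (suc k) b) (g zero) + sum (λ i → Σ< (suc b) (tails i))
    ≈⟨ +-congˡ (sum-cong-≋ λ i → Σ-box-suc k b (g (suc i))) ⟨
  sum (λ i → Σᴸ (boundedTuples (suc k) b) (g i)) ∎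
  where
  box = boundedTuples k b

  g′ : Fin (suc k) × Vec ℕ (suc k) → ℂ
  g′ (i , c) = g i c

  heads : ℕ → ℂ
  heads x = Σᴸ box λ a → Σᴸ (decHead (x ∷ a)) g′

  tails : Fin k → ℕ → ℂ
  tails i x = Σᴸ box λ a → g (suc i) (x ∷ a)

  slice : ∀ x → Σᴸ box (λ a → Σᴸ (predecessors (x ∷ a)) g′)
                ≈ heads x + sum λ i → tails i x
  slice x = begin
    Σᴸ box (λ a → Σᴸ (predecessors (x ∷ a)) g′)
      ≈⟨ Σᴸ-cong box (λ a → trans (Σᴸ-++ (decHead (x ∷ a)) _ g′)
           (+-congˡ (Σᴸ-map (underHead x) (predecessors a) g′))) ⟩
    Σᴸ box (λ a → Σᴸ (decHead (x ∷ a)) g′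
                  + Σᴸ (predecessors a) λ (i , c) → g (suc i) (x ∷ c))
      ≈⟨ Σᴸ-+ box _ _ ⟩
    heads x + Σᴸ box (λ a → Σᴸ (predecessors a) λ (i , c) → g (suc i) (x ∷ c))
      ≈⟨ +-congˡ (Σ-predecessors k b (λ i c → g (suc i) (x ∷ c))
                    (λ i a e → g≈0 (suc i) (x ∷ a) e)) ⟩
    heads x + sum (λ i → tails i x) ∎

  column : ℕ → ℂ
  column x = Σᴸ box λ a → g zero (x ∷ a)

  -- Head 0 has no predecessor and head `suc x` contributes `column x`. This leaves out `column b`,
  -- which is added back as zero.
  all-heads : Σ< (suc b) heads ≈ Σᴸ (boundedTuples (suc k) b) (g zero)
  all-heads = begin
    heads 0 + Σ< b (heads ∘ suc)
      ≈⟨ +-cong (Σᴸ-zero box) (Σ<-cong b λ x _ → Σᴸ-cong box λ a → +-identityʳ (g zero (x ∷ a))) ⟩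
    0# + Σ< b column
      ≈⟨ trans (+-identityˡ _) (sym (+-identityʳ _)) ⟩
    Σ< b column + 0#
      ≈⟨ +-congˡ (trans (Σᴸ-cong box λ a → g≈0 zero (b ∷ a) ≡.refl) (Σᴸ-zero box)) ⟨
    Σ< b column + column b
      ≈⟨ Σ<-last b column ⟨
    Σ< (suc b) column
      ≈⟨ Σ-box-suc k b (g zero) ⟨
    Σᴸ (boundedTuples (suc k) b) (g zero) ∎

-- The recurrence for the generalized Fibonacci polynomials

when : ∀ {P : Set} → Dec P → ℂ → ℂ
when (yes _) z = z
when (no _)  z = 0#

when-yes : ∀ {P : Set} (d : Dec P) {z} → P → when d z ≈ z
when-yes (yes _) _ = refl
when-yes (no ¬p) p = contradiction p ¬p

when-no : ∀ {P : Set} (d : Dec P) {z} → ¬ P → when d z ≈ 0#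
when-no (yes p) ¬p = contradiction p ¬p
when-no (no _)  _  = refl

term : ∀ {k} → Vector ℂ k → Vec ℕ k → ℂ
term t a = multinomial a · monomial t a

-- The coefficient of xʷ in ∑ₐ term t a x^(weight a), over all a ∈ {0, …, b}ᵏ.
boxCoefficient : ∀ {k} → ℕ → Vector ℂ k → ℕ → ℂ
boxCoefficient {k} b t w =
  Σᴸ (boundedTuples k b) λ a → when (weight a ℕₚ.≟ w) (term t a)

F≈boxCoefficient : ∀ n (t : Vector ℂ n) → F n t ≈ boxCoefficient n t n
F≈boxCoefficient n t = Σᴸ-filter (λ a → weight a ℕₚ.≟ n) (boundedTuples n n) (term t) _
  (λ a e → sym (when-yes (weight a ℕₚ.≟ n) e)) (λ a ¬e → sym (when-no (weight a ℕₚ.≟ n) ¬e))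

lookup≤weighted : ∀ {k} (c : Fin k → ℕ) i (a : Vec ℕ k) → c i ℕ.* lookup a i ℕ.≤ weighted c a
lookup≤weighted c zero    (x ∷ a) = ℕₚ.m≤m+n _ _
lookup≤weighted c (suc i) (x ∷ a) =
  ℕₚ.≤-trans (lookup≤weighted (c ∘ suc) i a) (ℕₚ.m≤n+m _ _)

-- Lowering entry `i` lowers the weight by `suc (toℕ i)` and takes a factor `t i` out of the
-- monomial. The weight condition is written with a sum because truncated subtraction would admit
-- false matches when `toℕ i` exceeds `w`.
term-recurrence : ∀ {k} (t : Vector ℂ k) w a →
  when (weight a ℕₚ.≟ suc w) (term t a) ≈
  Σᴸ (predecessors a) λ (i , b) → t i * when (toℕ i ℕ.+ weight b ℕₚ.≟ w) (term t b)
term-recurrence {k} t w a with weight a ℕₚ.≟ suc w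
... | no ≢w = sym (trans (Σᴸ-cong-All (All.map (λ {(i , b)} → vanish i b) (predecessors-inc a)))
                   (Σᴸ-zero (predecessors a)))
  where
  vanish : ∀ i b → a ≡ inc i b → t i * when (toℕ i ℕ.+ weight b ℕₚ.≟ w) (term t b) ≈ 0#
  vanish i b ≡.refl = trans (*-congˡ (when-no (toℕ i ℕ.+ weight b ℕₚ.≟ w) λ e →
    ≢w (≡.trans (weighted-inc (suc ∘ toℕ) i b) (≡.cong suc e)))) (zeroʳ _)
... | yes ≡w = begin
  multinomial a · monomial t a
    -- Positive weight excludes the zero tuple, where the multinomial recurrence fails.
    ≡⟨ ≡.cong (_· monomial t a) (multinomial-recurrence a λ e →
         ℕₚ.0≢1+n (≡.trans (≡.sym (sum≡0⇒weighted≡0 (suc ∘ toℕ) a e)) ≡w)) ⟨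
  ℕΣ.Σᴸ (predecessors a) (λ (i , b) → multinomial b) · monomial t a
    ≈⟨ Σᴸ-· (predecessors a) _ _ ⟨
  Σᴸ (predecessors a) (λ (i , b) → multinomial b · monomial t a)
    ≈⟨ Σᴸ-cong-All (All.map (λ {(i , b)} → match i b) (predecessors-inc a)) ⟩
  Σᴸ (predecessors a) (λ (i , b) → t i * when (toℕ i ℕ.+ weight b ℕₚ.≟ w) (term t b)) ∎
  where
  match : ∀ i b → a ≡ inc i b → multinomial b · monomial t a ≈
          t i * when (toℕ i ℕ.+ weight b ℕₚ.≟ w) (term t b)
  match i b ≡.refl = begin
    multinomial b · monomial t (inc i b)     ≈⟨ ×-congʳ (multinomial b) (monomial-inc t i b) ⟩
    multinomial b · (t i * monomial t b)     ≈⟨ ×-comm-* (multinomial b) (t i) (monomial t b) ⟨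
    t i * term t b                           ≈⟨ *-congˡ (when-yes (toℕ i ℕ.+ weight b ℕₚ.≟ w) (ℕₚ.suc-injective
                                                  (≡.trans (≡.sym (weighted-inc (suc ∘ toℕ) i b)) ≡w))) ⟨
    t i * when (toℕ i ℕ.+ weight b ℕₚ.≟ w) (term t b) ∎

sum≤weighted : ∀ {k} (c : Fin k → ℕ) a → Vec.sum a ℕ.≤ weighted (suc ∘ c) a
sum≤weighted c []      = ℕ.z≤n
sum≤weighted c (x ∷ a) = ℕₚ.+-mono-≤ (ℕₚ.m≤m+n x _) (sum≤weighted (c ∘ suc) a)

Σ-box-origin : ∀ k b {f : Vec ℕ k → ℂ} → (∀ a → Vec.sum a ≢ 0 → f a ≈ 0#) →
               Σᴸ (boundedTuples k b) f ≈ f (Vec.replicate k 0)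
Σ-box-origin zero    b     f≈0 = +-identityʳ _
Σ-box-origin (suc k) b {f} f≈0 = begin
  Σᴸ (boundedTuples (suc k) b) f
    ≈⟨ Σ-box-suc k b f ⟩
  Σᴸ box (λ a → f (0 ∷ a)) + Σ< b (λ x → Σᴸ box λ a → f (suc x ∷ a))
    ≈⟨ +-congˡ (sum-zero {b} λ x → trans
         (Σᴸ-cong box λ a → f≈0 (suc (toℕ x) ∷ a) λ ()) (Σᴸ-zero box)) ⟩
  Σᴸ box (λ a → f (0 ∷ a)) + 0#
    ≈⟨ +-identityʳ _ ⟩
  Σᴸ box (λ a → f (0 ∷ a))
    ≈⟨ Σ-box-origin k b (λ a → f≈0 (0 ∷ a)) ⟩
  f (Vec.replicate (suc k) 0) ∎
  where box = boundedTuples k b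

term-origin : ∀ {k} (t : Vector ℂ k) → term t (Vec.replicate k 0) ≈ 1#
term-origin {k} t = trans
  (reflexive (≡.cong (_· monomial t (Vec.replicate k 0)) (multinomial-origin k)))
  (trans (×-homo-1 _) (monomial-origin t))
  where
  ∏!-origin : ∀ k → ∏! (Vec.replicate k 0) ≡ 1
  ∏!-origin zero    = ≡.refl
  ∏!-origin (suc k) = ≡.trans (ℕₚ.+-identityʳ _) (∏!-origin k)

  sum-origin : ∀ k → Vec.sum (Vec.replicate k 0) ≡ 0
  sum-origin zero    = ≡.refl
  sum-origin (suc k) = sum-origin k

  multinomial-origin : ∀ k → multinomial (Vec.replicate k 0) ≡ 1
  multinomial-origin k = ≡.trans (≡.sym (ℕₚ.*-identityˡ (multinomial a)))
    (≡.trans (≡.cong (ℕ._* multinomial a) (≡.sym (∏!-origin k)))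
      (≡.trans (∏!*multinomial a) (≡.cong _! (sum-origin k))))
    where a = Vec.replicate k 0

  monomial-origin : ∀ {k} (t : Vector ℂ k) → monomial t (Vec.replicate k 0) ≈ 1#
  monomial-origin {zero}  t = refl
  monomial-origin {suc k} t = trans (*-identityˡ _) (monomial-origin (t ∘ suc))

boxCoefficient-zero : ∀ b {k} (t : Vector ℂ k) → boxCoefficient b t 0 ≈ 1#
boxCoefficient-zero b {k} t = begin
  boxCoefficient b t 0
    ≈⟨ Σ-box-origin k b (λ a sum≢0 → when-no (weight a ℕₚ.≟ 0) λ e →
         sum≢0 (ℕₚ.n≤0⇒n≡0 (≡.subst (Vec.sum a ℕ.≤_) e (sum≤weighted toℕ a)))) ⟩
  when (weight origin ℕₚ.≟ 0) (term t origin)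
    ≈⟨ when-yes (weight origin ℕₚ.≟ 0) (weight-origin k toℕ) ⟩
  term t origin
    ≈⟨ term-origin t ⟩
  1# ∎
  where
  origin = Vec.replicate k 0

  weight-origin : ∀ k (c : Fin k → ℕ) → weighted (suc ∘ c) (Vec.replicate k 0) ≡ 0
  weight-origin zero    c = ≡.refl
  weight-origin (suc k) c rewrite ℕₚ.*-zeroʳ (c zero) = weight-origin k (c ∘ suc)

initial : ∀ k → (ℕ → ℂ) → Vector ℂ k
initial k t i = t (toℕ i)

-- The bound on `b` makes every tuple with an entry `b` too heavy, as `Σ-predecessors` demands; the
-- bound on `k` makes all of `t 0`, ..., `t w` available.
boxCoefficient-suc : ∀ b k t w → suc w ℕ.≤ b → suc w ℕ.≤ k →
  boxCoefficient b (initial k t) (suc w) ≈ (t ⊛ boxCoefficient b (initial k t)) w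
boxCoefficient-suc b k t w w<b w<k = begin
  boxCoefficient b (initial k t) (suc w)
    ≈⟨ Σᴸ-cong box (term-recurrence (initial k t) w) ⟩
  Σᴸ box (λ a → Σᴸ (predecessors a) λ (i , c) → summand (toℕ i) c)
    ≈⟨ Σ-predecessors k b (summand ∘ toℕ) large ⟩
  Σ< k (λ i → Σᴸ box (summand i))
    ≈⟨ Σ<-truncate (λ i → Σᴸ box (summand i)) w<k (λ i w<i _ → trans
         (Σᴸ-cong box λ a → outside i a (ℕₚ.≤-trans w<i (ℕₚ.m≤m+n i _))) (Σᴸ-zero box)) ⟩
  Σ< (suc w) (λ i → Σᴸ box (summand i))
    ≈⟨ Σ<-cong (suc w) (λ i i≤w → trans
         (Σᴸ-cong box λ a → inside i a (ℕₚ.≤-pred i≤w)) (Σᴸ-*ˡ (t i) box _)) ⟩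
  (t ⊛ boxCoefficient b (initial k t)) w ∎
  where
  box = boundedTuples k b

  summand : ℕ → Vec ℕ k → ℂ
  summand i c = t i * when (i ℕ.+ weight c ℕₚ.≟ w) (term (initial k t) c)

  outside : ∀ i a → w ℕ.< i ℕ.+ weight a → summand i a ≈ 0#
  outside i a w<i = trans (*-congˡ (when-no (i ℕ.+ weight a ℕₚ.≟ w) (ℕₚ.>⇒≢ w<i))) (zeroʳ _)

  large : ∀ i a → lookup a i ≡ b → summand (toℕ i) a ≈ 0#
  large i a ≡.refl = outside (toℕ i) a (ℕₚ.≤-trans w<b (ℕₚ.≤-trans
    (ℕₚ.≤-trans (ℕₚ.m≤m+n _ _) (lookup≤weighted (suc ∘ toℕ) i a)) (ℕₚ.m≤n+m _ (toℕ i))))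

  inside : ∀ i a → i ℕ.≤ w →
           summand i a ≈ t i * when (weight a ℕₚ.≟ w ∸ i) (term (initial k t) a)
  inside i a i≤w with weight a ℕₚ.≟ w ∸ i
  ... | yes e = *-congˡ (when-yes (i ℕ.+ weight a ℕₚ.≟ w) (≡.trans (≡.cong (i ℕ.+_) e) (ℕₚ.m+[n∸m]≡n i≤w)))
  ... | no ≢  = *-congˡ (when-no (i ℕ.+ weight a ℕₚ.≟ w) λ e →
    ≢ (≡.trans (≡.sym (ℕₚ.m+n∸m≡n i (weight a))) (≡.cong (_∸ i) e)))

-- The recurrence for `F (suc n)` yields lower coefficients in the box and variables of `suc n`,
-- whereas `F m` uses those of `m`. Both versions obey one recurrence with the same start, so they
-- agree.
boxCoefficient-unique : ∀ t w {b k b′ k′} →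
  w ℕ.≤ b → w ℕ.≤ k → w ℕ.≤ b′ → w ℕ.≤ k′ →
  boxCoefficient b (initial k t) w ≈ boxCoefficient b′ (initial k′ t) w
boxCoefficient-unique t = <-rec P go
  where
  P : ℕ → Set
  P w = ∀ {b k b′ k′} → w ℕ.≤ b → w ℕ.≤ k → w ℕ.≤ b′ → w ℕ.≤ k′ →
    boxCoefficient b (initial k t) w ≈ boxCoefficient b′ (initial k′ t) w

  go : ∀ w → (∀ {v} → v ℕ.< w → P v) → P w
  go zero    rec {b} {k} {b′} {k′} _ _ _ _ = trans
    (boxCoefficient-zero b (initial k t)) (sym (boxCoefficient-zero b′ (initial k′ t)))
  go (suc w) rec {b} {k} {b′} {k′} w<b w<k w<b′ w<k′ = begin
    boxCoefficient b (initial k t) (suc w)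
      ≈⟨ boxCoefficient-suc b k t w w<b w<k ⟩
    (t ⊛ boxCoefficient b (initial k t)) w
      ≈⟨ ⊛-congˡ-≤ t _ _ w (λ v v≤w → rec (ℕ.s≤s v≤w) (below v≤w w<b)
           (below v≤w w<k) (below v≤w w<b′) (below v≤w w<k′)) ⟩
    (t ⊛ boxCoefficient b′ (initial k′ t)) w
      ≈⟨ boxCoefficient-suc b′ k′ t w w<b′ w<k′ ⟨
    boxCoefficient b′ (initial k′ t) (suc w) ∎
    where
    below : ∀ {v c} → v ℕ.≤ w → suc w ℕ.≤ c → v ℕ.≤ c
    below v≤w w<c = ℕₚ.≤-trans v≤w (ℕₚ.<⇒≤ w<c)

fibonacci : (ℕ → ℂ) → ℕ → ℂ
fibonacci t n = F n (initial n t)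

fibonacci-suc : ∀ t n → fibonacci t (suc n) ≈ (t ⊛ fibonacci t) n
fibonacci-suc t n = begin
  fibonacci t (suc n)
    ≈⟨ F≈boxCoefficient (suc n) (initial (suc n) t) ⟩
  boxCoefficient (suc n) (initial (suc n) t) (suc n)
    ≈⟨ boxCoefficient-suc (suc n) (suc n) t n ℕₚ.≤-refl ℕₚ.≤-refl ⟩
  (t ⊛ boxCoefficient (suc n) (initial (suc n) t)) n
    ≈⟨ ⊛-congˡ-≤ t _ _ n (λ m m≤n → trans
         (boxCoefficient-unique t m (ℕₚ.m≤n⇒m≤1+n m≤n) (ℕₚ.m≤n⇒m≤1+n m≤n) ℕₚ.≤-refl ℕₚ.≤-refl)
         (sym (F≈boxCoefficient m (initial m t)))) ⟩
  (t ⊛ fibonacci t) n ∎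

-- 1 − t₁ x − t₂ x² − …
connection : (ℕ → ℂ) → ℕ → ℂ
connection t zero    = 1#
connection t (suc n) = - t n

connection-⊛-fibonacci : ∀ t → connection t ⊛ fibonacci t ≐ one
connection-⊛-fibonacci t zero    = trans (+-identityʳ _) (trans (*-identityˡ _)
  (trans (F≈boxCoefficient 0 (initial 0 t)) (boxCoefficient-zero 0 (initial 0 t))))
connection-⊛-fibonacci t (suc n) = begin
  1# * fibonacci t (suc n) + ((-_ ∘ t) ⊛ fibonacci t) n
    ≈⟨ +-cong (trans (*-identityˡ _) (fibonacci-suc t n)) (-‿⊛ t (fibonacci t) n) ⟩
  (t ⊛ fibonacci t) n + - (t ⊛ fibonacci t) n
    ≈⟨ -‿inverseʳ _ ⟩
  0# ∎

-- Arithmetic functions at a prime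

-- By Euclid's lemma `p` divides the cofactor or `d`; cancelling it there lowers `n`.
∣p^n⇒≡p^i : ∀ {p} → Prime p → ∀ n {d} → d ∣ p ℕ.^ n → ∃ λ i → d ≡ p ℕ.^ i
∣p^n⇒≡p^i {p} p-prime zero    d∣1 = 0 , ∣1⇒≡1 d∣1
∣p^n⇒≡p^i {p} p-prime (suc n) {d} (divides q e)
  with euclidsLemma q d p-prime (divides (p ℕ.^ n) (≡.trans (≡.sym e) (ℕₚ.*-comm p _)))
... | inj₁ (divides q′ ≡.refl) = ∣p^n⇒≡p^i p-prime n (divides q′ (cancel (≡.trans e
        (≡.trans (≡.cong (ℕ._* d) (ℕₚ.*-comm q′ p)) (ℕₚ.*-assoc p q′ d)))))
  where
  cancel : ∀ {x y} → p ℕ.* x ≡ p ℕ.* y → x ≡ y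
  cancel = ℕₚ.*-cancelˡ-≡ _ _ p {{prime⇒nonZero p-prime}}
... | inj₂ (divides d′ ≡.refl)
  with ∣p^n⇒≡p^i p-prime n {d′} (divides q (ℕₚ.*-cancelʳ-≡ _ _ p {{prime⇒nonZero p-prime}}
        (≡.trans (ℕₚ.*-comm _ p) (≡.trans e (≡.sym (ℕₚ.*-assoc q d′ p))))))
... | i , ≡.refl = suc i , ℕₚ.*-comm (p ℕ.^ i) p

-- Proofs of `NonZero` are irrelevant, so equal arguments give equal values whatever the instances.
arithmetic-cong : ∀ (α : Arithmetic) {m n} .{{_ : ℕ.NonZero m}} .{{_ : ℕ.NonZero n}} →
                  m ≡ n → α m ≡ α n
arithmetic-cong α ≡.refl = ≡.refl

idempotent⇒≈1 : ∀ {z} → z * z ≈ z → z ≉ 0# → z ≈ 1#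
idempotent⇒≈1 {z} zz≈z z≉0 = x∙y⁻¹≈ε⇒x≈y z 1# (*-cancel-≉0 (begin
  z * (z + - 1#)      ≈⟨ distribˡ z z (- 1#) ⟩
  z * z + z * - 1#    ≈⟨ +-cong zz≈z (trans (*-comm z (- 1#)) (-1*x≈-x z)) ⟩
  z + - z             ≈⟨ -‿inverseʳ z ⟩
  0#                  ∎) z≉0)

-- `α 1` is idempotent, and `α` would vanish identically if it were zero. The second hypothesis is
-- the instance shared by multiplicative and completely multiplicative functions.
value-at-1 : ∀ (α : Arithmetic) → ¬ (∀ n → .{{_ : ℕ.NonZero n}} → α n ≈ 0#) →
             (∀ n .{{_ : ℕ.NonZero n}} → α (1 ℕ.* n) {{ℕₚ.m*n≢0 1 n}} ≈ α 1 * α n) →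
             α 1 ≈ 1#
value-at-1 α nonvanishing homo = idempotent⇒≈1 (sym (homo 1)) λ α1≈0 →
  nonvanishing λ n → begin
    α n                             ≡⟨ arithmetic-cong α {{ℕₚ.m*n≢0 1 n}} (ℕₚ.*-identityˡ n) ⟨
    α (1 ℕ.* n) {{ℕₚ.m*n≢0 1 n}}    ≈⟨ homo n ⟩
    α 1 * α n                       ≈⟨ *-congʳ α1≈0 ⟩
    0# * α n                        ≈⟨ zeroˡ _ ⟩
    0#                              ∎

-- ∏ᵢ (1 − bᵢ x)
denominator : ∀ {r} → Vector ℂ r → ℕ → ℂ
denominator {zero}  b = one
denominator {suc r} b = linear (- b zero) (denominator (b ∘ suc))

denominator-zero : ∀ {r} (b : Vector ℂ r) → denominator b 0 ≈ 1#
denominator-zero {zero}  b = refl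
denominator-zero {suc r} b =
  trans (+-cong (denominator-zero (b ∘ suc)) (zeroʳ _)) (+-identityʳ _)

denominator-degree : ∀ {r} (b : Vector ℂ r) → (∀ i → b i ≉ 0#) →
                     HasDegree (denominator b) r
denominator-degree {zero}  b b≉0 = one-degree
denominator-degree {suc r} b b≉0 = linear-degree
  (λ -b≈0 → b≉0 zero (-x≈0⇒x≈0 -b≈0)) (denominator-degree (b ∘ suc) (b≉0 ∘ suc))
  where
  -x≈0⇒x≈0 : ∀ {x} → - x ≈ 0# → x ≈ 0#
  -x≈0⇒x≈0 e = trans (sym (-‿involutive _)) (trans (-‿cong e) -0#≈0#)

module _ {p : ℕ} (p-prime : Prime p) where

  private instance
    p≢0 : ℕ.NonZero p
    p≢0 = prime⇒nonZero p-prime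


  p^n≢0 : ∀ n → ℕ.NonZero (p ℕ.^ n)
  p^n≢0 n = ℕₚ.m^n≢0 p n

  1<p : 1 ℕ.< p
  1<p = ℕ.nonTrivial⇒n>1 p {{prime⇒nonTrivial p-prime}}

  -- The index d of a summand stands for the number suc d.
  Σ<-powers : ∀ n (h : ℕ → ℂ) → (∀ d → (∀ i → suc d ≢ p ℕ.^ i) → h d ≈ 0#) →
              Σ< (p ℕ.^ n) h ≈ Σ< (suc n) λ i → h (pred (p ℕ.^ i))
  Σ<-powers zero    h h≈0 = refl
  Σ<-powers (suc n) h h≈0 = begin
    Σ< (p ℕ.^ suc n) h
      ≡⟨ ≡.cong (λ m → Σ< m h) (ℕₚ.suc-pred (p ℕ.^ suc n) {{p^n≢0 (suc n)}}) ⟨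
    Σ< (suc q) h
      ≈⟨ Σ<-last q h ⟩
    Σ< q h + h q
      -- The dropped indices stand for numbers strictly between consecutive powers of `p`.
      ≈⟨ +-congʳ (Σ<-truncate h (ℕₚ.<⇒≤pred grow) λ i lower upper →
           h≈0 i λ j e → between i j lower upper e) ⟩
    Σ< (p ℕ.^ n) h + h q
      ≈⟨ +-congʳ (Σ<-powers n h h≈0) ⟩
    Σ< (suc n) (λ i → h (pred (p ℕ.^ i))) + h q
      ≈⟨ Σ<-last (suc n) (λ i → h (pred (p ℕ.^ i))) ⟨
    Σ< (suc (suc n)) (λ i → h (pred (p ℕ.^ i))) ∎
    where
    q = pred (p ℕ.^ suc n)

    grow : p ℕ.^ n ℕ.< p ℕ.^ suc n
    grow = ℕₚ.^-monoʳ-< p 1<p (ℕₚ.n<1+n n)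

    between : ∀ i j → p ℕ.^ n ℕ.≤ i → i ℕ.< q → suc i ≢ p ℕ.^ j
    between i j lower upper e with j ℕₚ.≤? n
    ... | yes j≤n = ℕₚ.<-irrefl ≡.refl (ℕₚ.<-≤-trans (ℕ.s≤s lower)
                      (≡.subst (ℕ._≤ p ℕ.^ n) (≡.sym e) (ℕₚ.^-monoʳ-≤ p j≤n)))
    ... | no j≰n  = ℕₚ.<-irrefl ≡.refl (ℕₚ.<-≤-trans upper
                      (ℕₚ.pred-mono-≤ (≡.subst (p ℕ.^ suc n ℕ.≤_) (≡.sym e)
                        (ℕₚ.^-monoʳ-≤ p (ℕₚ.≰⇒> j≰n)))))

  -- Nondivisors contribute zero and every divisor is a power of `p`, so the sum over all numbers up
  -- to `p ^ n` collapses to one over exponents.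
  ⋆-onPowers : ∀ α β →
    onPowers (α ⋆ β) p-prime ≐ onPowers α p-prime ⊛ onPowers β p-prime
  ⋆-onPowers α β n = begin
    Σ< (p ℕ.^ n) h
      ≈⟨ Σ<-powers n h (λ d ≢p^i → nondivisor d ≢p^i (suc d ∣? p ℕ.^ n)) ⟩
    Σ< (suc n) (λ i → h (pred (p ℕ.^ i)))
      ≈⟨ Σ<-cong (suc n) {h ∘ pred ∘ (p ℕ.^_)} (λ i i≤n →
           divisor i (ℕₚ.≤-pred i≤n) _ (ℕₚ.suc-pred (p ℕ.^ i) {{p^n≢0 i}})
             (suc (pred (p ℕ.^ i)) ∣? p ℕ.^ n)) ⟩
    (onPowers α p-prime ⊛ onPowers β p-prime) n ∎
    where
    instance _ = p^n≢0 n

    h : ℕ → ℂ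
    h d = convolutionTerm α β (p ℕ.^ n) (suc d) (suc d ∣? p ℕ.^ n)

    nondivisor : ∀ d → (∀ i → suc d ≢ p ℕ.^ i) → ∀ d∣? →
                 convolutionTerm α β (p ℕ.^ n) (suc d) d∣? ≈ 0#
    nondivisor d ≢p^i (no _)    = refl
    nondivisor d ≢p^i (yes d∣p^n) =
      let (i , e) = ∣p^n⇒≡p^i p-prime n d∣p^n in contradiction e (≢p^i i)

    divisor : ∀ i → i ℕ.≤ n → ∀ d → suc d ≡ p ℕ.^ i → ∀ d∣? →
              convolutionTerm α β (p ℕ.^ n) (suc d) d∣?
              ≈ onPowers α p-prime i * onPowers β p-prime (n ∸ i)
    divisor i i≤n d e (no ∤) = contradiction
      (divides (p ℕ.^ (n ∸ i)) (≡.trans p^n≡ (≡.cong (p ℕ.^ (n ∸ i) ℕ.*_) (≡.sym e)))) ∤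
      where
      p^n≡ : p ℕ.^ n ≡ p ℕ.^ (n ∸ i) ℕ.* p ℕ.^ i
      p^n≡ = ≡.trans (≡.cong (p ℕ.^_) (≡.sym (ℕₚ.m∸n+n≡m i≤n))) (ℕₚ.^-distribˡ-+-* p (n ∸ i) i)
    divisor i i≤n d e (yes d∣p^n@(divides c p^n≡)) = reflexive (≡.cong₂ _*_
      (arithmetic-cong α {{_}} {{p^n≢0 i}} e)
      (arithmetic-cong β {{quotient≢0 d∣p^n}} {{p^n≢0 (n ∸ i)}}
        (ℕₚ.*-cancelʳ-≡ c (p ℕ.^ (n ∸ i)) (suc d) (≡.trans (≡.sym p^n≡)
          (≡.trans (≡.cong (p ℕ.^_) (≡.sym (ℕₚ.m∸n+n≡m i≤n)))
            (≡.trans (ℕₚ.^-distribˡ-+-* p (n ∸ i) i) (≡.cong (p ℕ.^ (n ∸ i) ℕ.*_) (≡.sym e))))))))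

  δ-onPowers : onPowers δ p-prime ≐ one
  δ-onPowers zero    = refl
  δ-onPowers (suc n) = reflexive (δ>1 (p ℕ.^ suc n) {{p^n≢0 (suc n)}}
    (ℕₚ.<-≤-trans 1<p (ℕₚ.m≤m*n p (p ℕ.^ n) {{p^n≢0 n}})))
    where
    δ>1 : ∀ m .{{_ : ℕ.NonZero m}} → 1 ℕ.< m → δ m ≡ 0#
    δ>1 (suc (suc m)) _ = ≡.refl
    δ>1 1 (ℕ.s≤s ())

  degreeOne-onPowers : ∀ {β} → DegreeOneAt p-prime β → onPowers β p-prime ≐ (β p ^_)
  degreeOne-onPowers {β} β₁ zero    = value-at-1 β nonvanishing (λ n → homo 1 n)
    where open CompletelyMultiplicative (DegreeOneAt.completelyMultiplicative β₁)
  degreeOne-onPowers {β} β₁ (suc n) = trans (homo p (p ℕ.^ n) {{p≢0}} {{p^n≢0 n}})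
    (*-congˡ (degreeOne-onPowers β₁ n))
    where open CompletelyMultiplicative (DegreeOneAt.completelyMultiplicative β₁)

  convolutionProduct-⊛-denominator : ∀ {r} (β : Vector Arithmetic r) →
    (∀ i → DegreeOneAt p-prime (β i)) →
    onPowers (convolutionProduct β) p-prime ⊛ denominator (λ i → β i p) ≐ one
  convolutionProduct-⊛-denominator {zero}  β β₁ n = begin
    (onPowers δ p-prime ⊛ one) n   ≈⟨ ⊛-cong {g = one} δ-onPowers (λ _ → refl) n ⟩
    (one ⊛ one) n                  ≈⟨ one-⊛ one n ⟩
    one n                          ∎
  convolutionProduct-⊛-denominator {suc r} β β₁ n = begin
    (C ⊛ linear (- b) D) n                  ≈⟨ ⊛-linear (- b) C D n ⟩
    (linear (- b) C ⊛ D) n                  ≈⟨ ⊛-cong {g = D} (linear-cong (- b) C≐) (λ _ → refl) n ⟩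
    (linear (- b) ((b ^_) ⊛ C′) ⊛ D) n      ≈⟨ ⊛-cong {g = D} (geometric-⊛ b C′) (λ _ → refl) n ⟩
    (C′ ⊛ D) n                              ≈⟨ convolutionProduct-⊛-denominator (β ∘ suc) (β₁ ∘ suc) n ⟩
    one n                                   ∎
    where
    b = β zero p
    C = onPowers (convolutionProduct β) p-prime
    C′ = onPowers (convolutionProduct (β ∘ suc)) p-prime
    D = denominator (λ i → β (suc i) p)

    C≐ : C ≐ (b ^_) ⊛ C′
    C≐ n = trans (⋆-onPowers (β zero) (convolutionProduct (β ∘ suc)) n)
      (⊛-cong {g = C′} (degreeOne-onPowers (β₁ zero)) (λ _ → refl) n)

  -- The sign and the shift make `connection` of these parameters equal to `s`. Then `fibonacci` and
  -- the values of `α` are both inverse to it and agree by cancellation.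
  inverse⇒parameters : ∀ α {s} → s 0 ≈ 1# → s ⊛ onPowers α p-prime ≐ one →
                       IsParameters α p-prime (λ i → - s (suc i))
  inverse⇒parameters α {s} s₀≈1 sa≐one = ⊛-cancelˡ {connection t} refl λ n → begin
    (connection t ⊛ fibonacci t) n            ≈⟨ connection-⊛-fibonacci t n ⟩
    one n                                     ≈⟨ sa≐one n ⟨
    (s ⊛ onPowers α p-prime) n                ≈⟨ ⊛-cong {g = onPowers α p-prime} s≐ (λ _ → refl) n ⟩
    (connection t ⊛ onPowers α p-prime) n     ∎
    where
    t : ℕ → ℂ
    t i = - s (suc i)

    s≐ : s ≐ connection t
    s≐ zero    = s₀≈1
    s≐ (suc n) = sym (-‿involutive _)

  -- The types of identity, positive and negative functions

  type₁⇒identity : ∀ α → Type₁ α p-prime → IdentityAt α p-prime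
  type₁⇒identity α (t , params , (N , a≈0) , (M , t≈0)) = descend N a≈0
    where
    a = onPowers α p-prime

    inverse : a ⊛ connection t ≐ one
    inverse n = begin
      (a ⊛ connection t) n             ≈⟨ ⊛-comm a (connection t) n ⟩
      (connection t ⊛ a) n             ≈⟨ ⊛-cong {connection t} (λ _ → refl) params n ⟨
      (connection t ⊛ fibonacci t) n   ≈⟨ connection-⊛-fibonacci t n ⟩
      one n                            ∎

    connection≈0 : EventuallyZero (connection t)
    connection≈0 = suc M , λ { (suc n) (ℕ.s≤s M≤n) → trans (-‿cong (t≈0 n M≤n)) -0#≈0# }

    -- A nonzero value at `suc k` would make `a` a polynomial of positive degree with a polynomial
    -- inverse. Hence that value is zero by stability, and the bound drops until it reaches 1.
    descend : ∀ N → (∀ n → N ℕ.≤ n → a n ≈ 0#) → IdentityAt α p-prime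
    descend zero          a≈0 n _   = a≈0 n ℕ.z≤n
    descend 1             a≈0 n 1≤n = a≈0 n 1≤n
    descend (suc (suc k)) a≈0       = descend (suc k) λ n k<n →
      case n (ℕₚ.m≤n⇒m<n∨m≡n k<n)
      where
      leading≈0 : a (suc k) ≈ 0#
      leading≈0 = ≈0-stable λ leading → polynomial-inverse-infinite (ℕ.s≤s ℕ.z≤n)
        (record { leading = leading ; above = a≈0 }) inverse connection≈0

      case : ∀ n → suc k ℕ.< n ⊎ suc k ≡ n → a n ≈ 0#
      case n (inj₁ k<n)    = a≈0 n k<n
      case n (inj₂ ≡.refl) = leading≈0

  identity⇒type₁ : ∀ α → Multiplicative α → IdentityAt α p-prime → Type₁ α p-prime
  identity⇒type₁ α α-mult a≈0 =
    (λ i → - one (suc i))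
    , inverse⇒parameters α {one} refl (λ n → trans (one-⊛ (onPowers α p-prime) n) (a≐one n))
    , (1 , a≈0)
    , (0 , λ _ _ → -0#≈0#)
    where
    open Multiplicative α-mult

    a≐one : onPowers α p-prime ≐ one
    a≐one zero    = value-at-1 α nonvanishing λ n → homo 1 n (gcd-zeroˡ n)
    a≐one (suc n) = a≈0 (suc n) (ℕ.s≤s ℕ.z≤n)

  positive⇒type₂ : ∀ α → PositiveAt α p-prime → Type₂ α p-prime
  positive⇒type₂ α (r , 1≤r , β , β₁ , a≐C) =
    (λ i → - D (suc i))
    , inverse⇒parameters α {D} (denominator-zero b) D⊛a≐one
    , polynomial-inverse-infinite 1≤r D-degree D⊛a≐one
    -- Parameter `i` is a coefficient of index `suc i`, so the degree `r` already serves as bound.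
    , (r , λ i r≤i → trans (-‿cong (HasDegree.above D-degree (suc i) (ℕ.s≤s r≤i))) -0#≈0#)
    where
    b : Vector ℂ r
    b i = β i p
    a = onPowers α p-prime
    C = onPowers (convolutionProduct β) p-prime
    D = denominator b

    D-degree : HasDegree D r
    D-degree = denominator-degree b (λ i → DegreeOneAt.nonzero (β₁ i))

    D⊛a≐one : D ⊛ a ≐ one
    D⊛a≐one n = begin
      (D ⊛ a) n   ≈⟨ ⊛-cong {D} (λ _ → refl) a≐C n ⟩
      (D ⊛ C) n   ≈⟨ ⊛-comm D C n ⟩
      (C ⊛ D) n   ≈⟨ convolutionProduct-⊛-denominator β β₁ n ⟩
      one n       ∎

  -- The roles are exchanged: the parameters come from the product `C`, while `a` is the denominator
  -- `D` because both are inverse to `C`. If the parameters ended, `C` would be a polynomial inverse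
  -- of `D`.
  negative⇒type₃ : ∀ α → NegativeAt α p-prime → Type₃ α p-prime
  negative⇒type₃ α (r , 1≤r , β , β₁ , αC≐δ) =
    (λ i → - C (suc i))
    , inverse⇒parameters α {C} C₀≈1 C⊛a≐one
    , (suc r , λ n r<n → trans (a≐D n) (HasDegree.above D-degree n r<n))
    , λ (N , t≈0) → polynomial-inverse-infinite 1≤r D-degree
        (λ n → trans (⊛-comm D C n) (C⊛D≐one n))
        (suc N , λ { (suc n) (ℕ.s≤s N≤n) →
          trans (sym (-‿involutive _)) (trans (-‿cong (t≈0 n N≤n)) -0#≈0#) })
    where
    b : Vector ℂ r
    b i = β i p
    a = onPowers α p-prime
    C = onPowers (convolutionProduct β) p-prime
    D = denominator b

    D-degree : HasDegree D r
    D-degree = denominator-degree b (λ i → DegreeOneAt.nonzero (β₁ i))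

    C⊛D≐one : C ⊛ D ≐ one
    C⊛D≐one = convolutionProduct-⊛-denominator β β₁

    C⊛a≐one : C ⊛ a ≐ one
    C⊛a≐one n = begin
      (C ⊛ a) n                                    ≈⟨ ⊛-comm C a n ⟩
      (a ⊛ C) n                                    ≈⟨ ⋆-onPowers α (convolutionProduct β) n ⟨
      onPowers (α ⋆ convolutionProduct β) p-prime n ≈⟨ αC≐δ n ⟩
      onPowers δ p-prime n                         ≈⟨ δ-onPowers n ⟩
      one n                                        ∎

    C₀≈1 : C 0 ≈ 1#
    C₀≈1 = begin
      C 0              ≈⟨ trans (*-congˡ (denominator-zero b)) (*-identityʳ _) ⟨
      C 0 * D 0        ≈⟨ +-identityʳ _ ⟨
      (C ⊛ D) 0        ≈⟨ C⊛D≐one 0 ⟩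
      1#               ∎

    a≐D : a ≐ D
    a≐D = ⊛-cancelˡ {C} C₀≈1 λ n → trans (C⊛a≐one n) (sym (C⊛D≐one n))

theorem10 : (p : ℕ) (p-prime : Prime p) (α : Arithmetic) → Multiplicative α →
    (Type₁ α p-prime ⇔ IdentityAt α p-prime) ×
    (PositiveAt α p-prime → Type₂ α p-prime) ×
    (NegativeAt α p-prime → Type₃ α p-prime)
theorem10 p p-prime α α-mult =
  mk⇔ (type₁⇒identity p-prime α) (identity⇒type₁ p-prime α α-mult)
  , positive⇒type₂ p-prime α
  , negative⇒type₃ p-prime α
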